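{- For every integer $n\ge0$ and every integer $N\ge1$, the following identity holds (as rational functions in $x$): $$\begin{aligned} &2^{N+1}N!\sum_{s+m+p=n}\binom{N+s}{s}\binom{m+N}{m}(-1)^{m}\,T_{p}^{(N+1)}(x)\\ &=\sum_{i=1}^{N}\sum_{l=0}^{i}a_{i}(N)\frac{i!}{l!}\sum_{m+s+p=n}\binom{2N+m-i-1}{m}\binom{i+s-l}{s}(p+l)_{l}\,x^{i-2N-m}\,T_{p+l}(x)\\ &\quad+\sum_{i=1}^{N}\sum_{l=0}^{i}a_{i}(N)\frac{i!}{l!}(-1)^{i-l}\sum_{m+s+p=n}(-1)^{s}\binom{2N+m-i-1}{m}\binom{i+s-l}{s}(p+l)_{l}\,x^{i-2N-m}\,T_{p+l}(x), \end{aligned}$$ where the sums over $m+s+p=n$ are over all integers $m,s,p\ge0$ with $m+s+p=n$.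
   Context: The polynomials $T_n(x)$ (Chebyshev polynomials of the first kind, in the normalization used here) and the higher-order ones $T_n^{(\alpha)}(x)$ are defined by the formal power series in $t$ $$\frac{1-t^{2}}{1-2xt+t^{2}}=\sum_{n=0}^{\infty}T_{n}(x)t^{n},\qquad \left(\frac{1-t^{2}}{1-2xt+t^{2}}\right)^{\alpha}=\sum_{n=0}^{\infty}T_{n}^{(\alpha)}(x)t^{n}.$$ (With this definition $T_0=1$, and for $n\ge1$ $T_n$ is twice the classical polynomial $\cos(n\arccos x)$.) For a number $y$ and integer $n\ge1$, $(y)_{n}=y(y-1)\cdots(y-n+1)$ is the falling factorial, and $(y)_{0}=1$. The double factorial is $(2k-1)!!=(2k-1)(2k-3)\cdots 3\cdot 1$ for $k\ge1$, with $(-1)!!=1$. The numbers $a_i(N)$, $1\le i\le N$, are defined by $a_{1}(N)=(2N-3)!!$ and, for $2\le i\le N$, $$a_{i}(N)=\sum_{k_{i-1}=0}^{N-i}\ \sum_{k_{i-2}=0}^{N-i-k_{i-1}}\cdots\sum_{k_{1}=0}^{N-i-k_{i-1}-\cdots-k_{2}}2^{\sum_{j=1}^{i-1}k_{j}}\left[\prod_{j=2}^{i}\left(N-\sum_{l=j}^{i-1}k_{l}-\frac{2i+2-j}{2}\right)_{k_{j-1}}\right]\left(2\left(N-i-\sum_{j=1}^{i-1}k_{j}\right)-1\right)!!,$$ where empty sums are $0$. -}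

module Defs where

open import Algebra.Bundles using (CommutativeMonoid; CommutativeRing)
import Algebra.Definitions
import Algebra.Properties.CommutativeSemigroup
import Algebra.Properties.Group
import Algebra.Properties.Ring
import Algebra.Properties.Semiring.Exp
import Algebra.Properties.Semiring.Sum
open import Algebra.Structures using (IsCommutativeRing)
open import Data.Fin.Base using (toℕ)
open import Data.Fin.Properties using (toℕ<n)
open import Data.Integer.Base as ℤ using (ℤ; +_; -[1+_])
open import Data.List.Base using (List; []; _∷_)
open import Data.Nat.Base as ℕ using (ℕ; zero; suc; _∸_; _≤_; s≤s; _!)
import Data.Nat.ListAction as ListAction
import Data.Nat.Properties as ℕₚ
open ℕₚ using (_!≢0)
open import Data.Product.Base using (_,_)
open import Data.Rational.Base as ℚ using (ℚ; 0ℚ; 1ℚ)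
import Data.Rational.Properties as ℚₚ
open import Data.Sum.Base using (_⊎_; inj₁; inj₂)
open import Function.Base using (_∘_; case_of_)
open import Level using (0ℓ; _⊔_)
open import Relation.Binary.Definitions using (Decidable)
open import Relation.Binary.PropositionalEquality as ≡ using (_≡_)
import Relation.Binary.Reasoning.Setoid
open import Relation.Binary.Structures using (IsEquivalence)
open import Relation.Nullary using (¬_; yes; no)
open import Relation.Nullary.Decidable using (decidable-stable)

NonTrivial : ∀ {c ℓ} → CommutativeRing c ℓ → Set ℓ
NonTrivial R = ¬ 1# ≈ 0#
  where open CommutativeRing R

AlmostCancellative : ∀ {c ℓ} → CommutativeRing c ℓ → Set (c ⊔ ℓ)
AlmostCancellative R = AlmostLeftCancellative 0# _*_
  where
  open CommutativeRing R
  open Algebra.Definitions _≈_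

module Sums {c ℓ} (R : CommutativeRing c ℓ) where
  open CommutativeRing R hiding (zero)
  open Algebra.Properties.Semiring.Sum semiring public
    using (sum; sum-cong-≋; sum-replicate-zero)

  sumRange : ℕ → ℕ → (ℕ → Carrier) → Carrier
  sumRange a b f = sum {suc b ∸ a} (λ i → f (a ℕ.+ toℕ i))

  infixl 5 sumRange
  syntax sumRange a b (λ i → e) = ∑[ a ≤ i ≤ b ] e

  sumTriples : ℕ → (ℕ → ℕ → ℕ → Carrier) → Carrier
  sumTriples n f = ∑[ 0 ≤ i ≤ n ] ∑[ 0 ≤ j ≤ n ∸ i ] f i j (n ∸ i ∸ j)

  infixl 5 sumTriples
  syntax sumTriples n (λ i j k → e) = ∑[ i + j + k ≡ n ] e

module PowerSeries {c ℓ} (R : CommutativeRing c ℓ) where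
  open CommutativeRing R hiding (zero)
  open Sums R
  open Algebra.Properties.CommutativeSemigroup
    (CommutativeMonoid.commutativeSemigroup +-commutativeMonoid) using (interchange)
  open Relation.Binary.Reasoning.Setoid setoid

  Series : Set c
  Series = ℕ → Carrier

  infix  4 _≈ₛ_
  infixl 6 _+ₛ_
  infixl 7 _*ₛ_ _·ₛ_ _÷ₛ_

  _≈ₛ_ : Series → Series → Set ℓ
  f ≈ₛ g = ∀ n → f n ≈ g n

  _+ₛ_ _*ₛ_ _÷ₛ_ : Series → Series → Series
  (f +ₛ g) n = f n + g n
  (f *ₛ g) n = ∑[ 0 ≤ i ≤ n ] f i * g (n ∸ i)

  _·ₛ_ : Carrier → Series → Series
  (a ·ₛ f) n = a * f n

  -ₛ_ : Series → Series
  (-ₛ f) n = - f n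

  0ₛ : Series
  0ₛ _ = 0#

  const : Carrier → Series
  const a zero    = a
  const a (suc _) = 0#

  var : Series
  var zero    = 0#
  var (suc n) = const 1# n

  -- The quotient f / g for g with constant term 1, by long division:
  -- writing f = f₀ + t f⁺ and g = 1 + t g⁺, one has
  -- f / g = f₀ + t ((f⁺ - f₀ g⁺) / g).  See ÷ₛ-* below.
  (f ÷ₛ g) zero    = f zero
  (f ÷ₛ g) (suc n) = (((f ∘ suc) +ₛ (-ₛ (f zero ·ₛ (g ∘ suc)))) ÷ₛ g) n

  *ₛ-cong : ∀ {f f′ g g′} → f ≈ₛ f′ → g ≈ₛ g′ → f *ₛ g ≈ₛ f′ *ₛ g′
  *ₛ-cong p q n = sum-cong-≋ {suc n} λ i → *-cong (p (toℕ i)) (q (n ∸ toℕ i))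

  *ₛ-sucʳ : ∀ f g n → (f *ₛ g) (suc n) ≈ (f *ₛ (g ∘ suc)) n + f (suc n) * g zero
  *ₛ-sucʳ f g zero = begin
    f 0 * g 1 + (f 1 * g 0 + 0#)  ≈⟨ +-congˡ (+-identityʳ _) ⟩
    f 0 * g 1 + f 1 * g 0         ≈⟨ +-congʳ (+-identityʳ _) ⟨
    f 0 * g 1 + 0# + f 1 * g 0    ∎
  *ₛ-sucʳ f g (suc n) = begin
    f 0 * g (2 ℕ.+ n) + ((f ∘ suc) *ₛ g) (suc n)
      ≈⟨ +-congˡ (*ₛ-sucʳ (f ∘ suc) g n) ⟩
    f 0 * g (2 ℕ.+ n) + (((f ∘ suc) *ₛ (g ∘ suc)) n + f (2 ℕ.+ n) * g 0)
      ≈⟨ +-assoc _ _ _ ⟨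
    f 0 * g (2 ℕ.+ n) + ((f ∘ suc) *ₛ (g ∘ suc)) n + f (2 ℕ.+ n) * g 0 ∎

  *ₛ-comm : ∀ f g → f *ₛ g ≈ₛ g *ₛ f
  *ₛ-comm f g zero    = +-congʳ (*-comm _ _)
  *ₛ-comm f g (suc n) = begin
    f 0 * g (suc n) + ((f ∘ suc) *ₛ g) n  ≈⟨ +-cong (*-comm _ _) (*ₛ-comm (f ∘ suc) g n) ⟩
    g (suc n) * f 0 + (g *ₛ (f ∘ suc)) n  ≈⟨ +-comm _ _ ⟩
    (g *ₛ (f ∘ suc)) n + g (suc n) * f 0  ≈⟨ *ₛ-sucʳ g f n ⟨
    (g *ₛ f) (suc n)                      ∎

  *ₛ-distribʳ : ∀ h f g → (f +ₛ g) *ₛ h ≈ₛ (f *ₛ h) +ₛ (g *ₛ h)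
  *ₛ-distribʳ h f g zero    = begin
    (f 0 + g 0) * h 0 + 0#               ≈⟨ +-cong (distribʳ _ _ _) (sym (+-identityʳ 0#)) ⟩
    (f 0 * h 0 + g 0 * h 0) + (0# + 0#)  ≈⟨ interchange _ _ _ _ ⟩
    (f 0 * h 0 + 0#) + (g 0 * h 0 + 0#)  ∎
  *ₛ-distribʳ h f g (suc n) = begin
    (f 0 + g 0) * h (suc n) + (((f ∘ suc) +ₛ (g ∘ suc)) *ₛ h) n
      ≈⟨ +-cong (distribʳ _ _ _) (*ₛ-distribʳ h (f ∘ suc) (g ∘ suc) n) ⟩
    (f 0 * h (suc n) + g 0 * h (suc n)) + (((f ∘ suc) *ₛ h) n + ((g ∘ suc) *ₛ h) n)
      ≈⟨ interchange _ _ _ _ ⟩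
    (f *ₛ h) (suc n) + (g *ₛ h) (suc n) ∎

  *ₛ-distribˡ : ∀ h f g → h *ₛ (f +ₛ g) ≈ₛ (h *ₛ f) +ₛ (h *ₛ g)
  *ₛ-distribˡ h f g n = begin
    (h *ₛ (f +ₛ g)) n          ≈⟨ *ₛ-comm h (f +ₛ g) n ⟩
    ((f +ₛ g) *ₛ h) n          ≈⟨ *ₛ-distribʳ h f g n ⟩
    (f *ₛ h) n + (g *ₛ h) n    ≈⟨ +-cong (*ₛ-comm f h n) (*ₛ-comm g h n) ⟩
    (h *ₛ f) n + (h *ₛ g) n    ∎

  ·ₛ-*ₛ : ∀ a f g → (a ·ₛ f) *ₛ g ≈ₛ a ·ₛ (f *ₛ g)
  ·ₛ-*ₛ a f g zero    = begin
    a * f 0 * g 0 + 0#    ≈⟨ +-identityʳ _ ⟩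
    a * f 0 * g 0         ≈⟨ *-assoc _ _ _ ⟩
    a * (f 0 * g 0)       ≈⟨ *-congˡ (+-identityʳ _) ⟨
    a * (f 0 * g 0 + 0#)  ∎
  ·ₛ-*ₛ a f g (suc n) = begin
    a * f 0 * g (suc n) + ((a ·ₛ (f ∘ suc)) *ₛ g) n
      ≈⟨ +-cong (*-assoc _ _ _) (·ₛ-*ₛ a (f ∘ suc) g n) ⟩
    a * (f 0 * g (suc n)) + a * ((f ∘ suc) *ₛ g) n
      ≈⟨ distribˡ _ _ _ ⟨
    a * (f *ₛ g) (suc n) ∎

  *ₛ-assoc : ∀ f g h → (f *ₛ g) *ₛ h ≈ₛ f *ₛ (g *ₛ h)
  *ₛ-assoc f g h zero    = begin
    (f 0 * g 0 + 0#) * h 0 + 0#    ≈⟨ +-congʳ (*-congʳ (+-identityʳ _)) ⟩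
    f 0 * g 0 * h 0 + 0#           ≈⟨ +-congʳ (*-assoc _ _ _) ⟩
    f 0 * (g 0 * h 0) + 0#         ≈⟨ +-congʳ (*-congˡ (+-identityʳ _)) ⟨
    f 0 * (g 0 * h 0 + 0#) + 0#    ∎
  *ₛ-assoc f g h (suc n) = begin
    (f 0 * g 0 + 0#) * h (suc n) + (((f 0 ·ₛ (g ∘ suc)) +ₛ ((f ∘ suc) *ₛ g)) *ₛ h) n
      ≈⟨ +-cong (*-congʳ (+-identityʳ _)) (*ₛ-distribʳ h (f 0 ·ₛ (g ∘ suc)) ((f ∘ suc) *ₛ g) n) ⟩
    f 0 * g 0 * h (suc n) + (((f 0 ·ₛ (g ∘ suc)) *ₛ h) n + (((f ∘ suc) *ₛ g) *ₛ h) n)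
      ≈⟨ +-cong (*-assoc _ _ _) (+-cong (·ₛ-*ₛ (f 0) (g ∘ suc) h n) (*ₛ-assoc (f ∘ suc) g h n)) ⟩
    f 0 * (g 0 * h (suc n)) + (f 0 * ((g ∘ suc) *ₛ h) n + ((f ∘ suc) *ₛ (g *ₛ h)) n)
      ≈⟨ +-assoc _ _ _ ⟨
    f 0 * (g 0 * h (suc n)) + f 0 * ((g ∘ suc) *ₛ h) n + ((f ∘ suc) *ₛ (g *ₛ h)) n
      ≈⟨ +-congʳ (distribˡ _ _ _) ⟨
    (f *ₛ (g *ₛ h)) (suc n) ∎

  *ₛ-zeroˡ : ∀ f g → f ≈ₛ 0ₛ → f *ₛ g ≈ₛ 0ₛ
  *ₛ-zeroˡ f g f≈0 n = begin
    (f *ₛ g) n                ≈⟨ sum-cong-≋ {suc n} (λ i → trans (*-congʳ (f≈0 (toℕ i))) (zeroˡ (g (n ∸ toℕ i)))) ⟩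
    sum {suc n} (λ _ → 0#)    ≈⟨ sum-replicate-zero (suc n) ⟩
    0#                        ∎

  *ₛ-identityˡ : ∀ f → const 1# *ₛ f ≈ₛ f
  *ₛ-identityˡ f zero    = trans (+-identityʳ _) (*-identityˡ _)
  *ₛ-identityˡ f (suc n) = begin
    1# * f (suc n) + (0ₛ *ₛ f) n  ≈⟨ +-cong (*-identityˡ _) (*ₛ-zeroˡ 0ₛ f (λ _ → refl) n) ⟩
    f (suc n) + 0#                ≈⟨ +-identityʳ _ ⟩
    f (suc n)                     ∎

  isCommutativeRingₛ : IsCommutativeRing _≈ₛ_ _+ₛ_ _*ₛ_ -ₛ_ 0ₛ (const 1#)
  isCommutativeRingₛ = record
    { isRing = record
      { +-isAbelianGroup = record
        { isGroup = record
          { isMonoid = record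
            { isSemigroup = record
              { isMagma = record
                { isEquivalence = record
                  { refl  = λ _ → refl
                  ; sym   = λ p n → sym (p n)
                  ; trans = λ p q n → trans (p n) (q n)
                  }
                ; ∙-cong = λ p q n → +-cong (p n) (q n)
                }
              ; assoc = λ f g h n → +-assoc (f n) (g n) (h n)
              }
            ; identity = (λ f n → +-identityˡ (f n)) , (λ f n → +-identityʳ (f n))
            }
          ; inverse = (λ f n → -‿inverseˡ (f n)) , (λ f n → -‿inverseʳ (f n))
          ; ⁻¹-cong = λ p n → -‿cong (p n)
          }
        ; comm = λ f g n → +-comm (f n) (g n)
        }
      ; *-cong     = *ₛ-cong
      ; *-assoc    = *ₛ-assoc
      ; *-identity = *ₛ-identityˡ , λ f n → trans (*ₛ-comm f (const 1#) n) (*ₛ-identityˡ f n)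
      ; distrib    = *ₛ-distribˡ , *ₛ-distribʳ
      }
    ; *-comm = *ₛ-comm
    }

  seriesRing : CommutativeRing c ℓ
  seriesRing = record { isCommutativeRing = isCommutativeRingₛ }

  ÷ₛ-* : ∀ f g → g 0 ≈ 1# → (f ÷ₛ g) *ₛ g ≈ₛ f
  ÷ₛ-* f g g₀≈1 zero    = begin
    f 0 * g 0 + 0#  ≈⟨ +-identityʳ _ ⟩
    f 0 * g 0       ≈⟨ *-congˡ g₀≈1 ⟩
    f 0 * 1#        ≈⟨ *-identityʳ _ ⟩
    f 0             ∎
  ÷ₛ-* f g g₀≈1 (suc n) = begin
    f 0 * g (suc n) + ((r ÷ₛ g) *ₛ g) n                ≈⟨ +-congˡ (÷ₛ-* r g g₀≈1 n) ⟩
    f 0 * g (suc n) + (f (suc n) - f 0 * g (suc n))    ≈⟨ +-comm _ _ ⟩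
    (f (suc n) - f 0 * g (suc n)) + f 0 * g (suc n)    ≈⟨ +-assoc _ _ _ ⟩
    f (suc n) + (- (f 0 * g (suc n)) + f 0 * g (suc n)) ≈⟨ +-congˡ (-‿inverseˡ _) ⟩
    f (suc n) + 0#                                     ≈⟨ +-identityʳ _ ⟩
    f (suc n)                                          ∎
    where
    r : Series
    r = (f ∘ suc) +ₛ (-ₛ (f 0 ·ₛ (g ∘ suc)))

  module _ (_≟_ : Decidable _≈_) (cancel : AlmostCancellative R) where

    noZeroDivisors₀ : ∀ f g → ¬ f 0 ≈ 0# → f *ₛ g ≈ₛ 0ₛ → g ≈ₛ 0ₛ
    noZeroDivisors₀ f g f₀≉0 fg≈0 zero    = cancel _ _ _ f₀≉0 (begin
      f 0 * g 0       ≈⟨ +-identityʳ _ ⟨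
      f 0 * g 0 + 0#  ≈⟨ fg≈0 0 ⟩
      0#              ≈⟨ zeroʳ _ ⟨
      f 0 * 0#        ∎)
    noZeroDivisors₀ f g f₀≉0 fg≈0 (suc n) = noZeroDivisors₀ f (g ∘ suc) f₀≉0 fg⁺≈0 n
      where
      fg⁺≈0 : f *ₛ (g ∘ suc) ≈ₛ 0ₛ
      fg⁺≈0 k = begin
        (f *ₛ (g ∘ suc)) k                      ≈⟨ +-identityʳ _ ⟨
        (f *ₛ (g ∘ suc)) k + 0#                 ≈⟨ +-congˡ (zeroʳ _) ⟨
        (f *ₛ (g ∘ suc)) k + f (suc k) * 0#     ≈⟨ +-congˡ (*-congˡ (noZeroDivisors₀ f g f₀≉0 fg≈0 0)) ⟨
        (f *ₛ (g ∘ suc)) k + f (suc k) * g 0    ≈⟨ *ₛ-sucʳ f g k ⟨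
        (f *ₛ g) (suc k)                        ≈⟨ fg≈0 (suc k) ⟩
        0#                                      ∎

    noZeroDivisors : ∀ k f g → ¬ f k ≈ 0# → f *ₛ g ≈ₛ 0ₛ → g ≈ₛ 0ₛ
    noZeroDivisors zero    f g fₖ≉0 fg≈0 = noZeroDivisors₀ f g fₖ≉0 fg≈0
    noZeroDivisors (suc k) f g fₖ≉0 fg≈0 with f 0 ≟ 0#
    ... | no  f₀≉0 = noZeroDivisors₀ f g f₀≉0 fg≈0
    ... | yes f₀≈0 = noZeroDivisors k (f ∘ suc) g fₖ≉0 λ n → begin
      ((f ∘ suc) *ₛ g) n                      ≈⟨ +-identityˡ _ ⟨
      0# + ((f ∘ suc) *ₛ g) n                 ≈⟨ +-congʳ (zeroˡ _) ⟨
      0# * g (suc n) + ((f ∘ suc) *ₛ g) n     ≈⟨ +-congʳ (*-congʳ f₀≈0) ⟨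
      (f *ₛ g) (suc n)                        ≈⟨ fg≈0 (suc n) ⟩
      0#                                      ∎

    *ₛ-almostCancelˡ : AlmostCancellative seriesRing
    *ₛ-almostCancelˡ f g h f≉0 fg≈fh n = x∙y⁻¹≈ε⇒x≈y _ _ g-h≈0
      where
      open Algebra.Properties.Group +-group using (x∙y⁻¹≈ε⇒x≈y)
      module S = CommutativeRing seriesRing

      f[g-h]≈0 : f *ₛ (g +ₛ (-ₛ h)) ≈ₛ 0ₛ
      f[g-h]≈0 k = begin
        (f *ₛ (g +ₛ (-ₛ h))) k        ≈⟨ Algebra.Properties.Ring.x[y-z]≈xy-xz S.ring f g h k ⟩
        (f *ₛ g) k - (f *ₛ h) k       ≈⟨ +-congʳ (fg≈fh k) ⟩
        (f *ₛ h) k - (f *ₛ h) k       ≈⟨ -‿inverseʳ _ ⟩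
        0#                            ∎

      g-h≈0 : g n - h n ≈ 0#
      g-h≈0 = decidable-stable (_ ≟ _) λ g-h≉0 → f≉0
        (noZeroDivisors n (g +ₛ (-ₛ h)) f g-h≉0
          (λ k → trans (*ₛ-comm (g +ₛ (-ₛ h)) f k) (f[g-h]≈0 k)))

module Polynomials {c ℓ} (R : CommutativeRing c ℓ) where
  open CommutativeRing R hiding (zero)
  open Sums R
  open PowerSeries R
  open Algebra.Properties.Ring ring using (-0#≈0#)
  open Relation.Binary.Reasoning.Setoid setoid
  private module S = CommutativeRing seriesRing

  record Polynomial : Set (c ⊔ ℓ) where
    field
      coeff    : Series
      bound    : ℕ
      vanishes : ∀ n → bound ≤ n → coeff n ≈ 0#
  open Polynomial public

  infix  4 _≈ₚ_
  infixl 6 _+ₚ_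
  infixl 7 _*ₚ_

  _≈ₚ_ : Polynomial → Polynomial → Set ℓ
  p ≈ₚ q = coeff p ≈ₛ coeff q

  private
    split : ∀ i j d e → d ℕ.+ e ≤ i ℕ.+ j → d ≤ i ⊎ e ≤ j
    split i j d e d+e≤i+j with ℕₚ.≤-<-connex d i
    ... | inj₁ d≤i = inj₁ d≤i
    ... | inj₂ i<d = inj₂ (ℕₚ.≮⇒≥ λ j<e →
      ℕₚ.<⇒≱ (ℕₚ.+-mono-< i<d j<e) d+e≤i+j)

  _+ₚ_ _*ₚ_ : Polynomial → Polynomial → Polynomial
  p +ₚ q = record
    { coeff    = coeff p +ₛ coeff q
    ; bound    = bound p ℕ.⊔ bound q
    ; vanishes = λ n d≤n → trans
        (+-cong (vanishes p n (ℕₚ.m⊔n≤o⇒m≤o (bound p) (bound q) d≤n))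
                (vanishes q n (ℕₚ.m⊔n≤o⇒n≤o (bound p) (bound q) d≤n)))
        (+-identityʳ 0#)
    }
  p *ₚ q = record
    { coeff    = coeff p *ₛ coeff q
    ; bound    = bound p ℕ.+ bound q
    ; vanishes = λ n d≤n → trans
        (sum-cong-≋ {suc n} λ i → term n d≤n (toℕ i) (ℕₚ.≤-pred (toℕ<n i)))
        (sum-replicate-zero (suc n))
    }
    where
    term : ∀ n → bound p ℕ.+ bound q ≤ n → ∀ i → i ≤ n → coeff p i * coeff q (n ∸ i) ≈ 0#
    term n d≤n i i≤n with split i (n ∸ i) (bound p) (bound q)
                            (ℕₚ.≤-trans d≤n (ℕₚ.≤-reflexive (≡.sym (ℕₚ.m+[n∸m]≡n i≤n))))
    ... | inj₁ le = trans (*-congʳ (vanishes p _ le)) (zeroˡ _)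
    ... | inj₂ le = trans (*-congˡ (vanishes q _ le)) (zeroʳ _)

  -ₚ_ : Polynomial → Polynomial
  -ₚ p = record
    { coeff    = -ₛ coeff p
    ; bound    = bound p
    ; vanishes = λ n d≤n → trans (-‿cong (vanishes p n d≤n)) -0#≈0#
    }

  0ₚ X : Polynomial
  0ₚ = record { coeff = 0ₛ ; bound = 0 ; vanishes = λ _ _ → refl }
  X  = record { coeff = var ; bound = 2 ; vanishes = λ { _ (s≤s (s≤s _)) → refl } }

  constₚ : Carrier → Polynomial
  constₚ a = record { coeff = const a ; bound = 1 ; vanishes = λ { _ (s≤s _) → refl } }

  isCommutativeRingₚ : IsCommutativeRing _≈ₚ_ _+ₚ_ _*ₚ_ -ₚ_ 0ₚ (constₚ 1#)
  isCommutativeRingₚ = record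
    { isRing = record
      { +-isAbelianGroup = record
        { isGroup = record
          { isMonoid = record
            { isSemigroup = record
              { isMagma = record
                { isEquivalence = record
                  { refl = S.refl ; sym = S.sym ; trans = S.trans }
                ; ∙-cong = S.+-cong
                }
              ; assoc = λ p q r → S.+-assoc (coeff p) (coeff q) (coeff r)
              }
            ; identity = (λ p → S.+-identityˡ (coeff p)) , (λ p → S.+-identityʳ (coeff p))
            }
          ; inverse = (λ p → S.-‿inverseˡ (coeff p)) , (λ p → S.-‿inverseʳ (coeff p))
          ; ⁻¹-cong = S.-‿cong
          }
        ; comm = λ p q → S.+-comm (coeff p) (coeff q)
        }
      ; *-cong     = S.*-cong
      ; *-assoc    = λ p q r → S.*-assoc (coeff p) (coeff q) (coeff r)
      ; *-identity = (λ p → S.*-identityˡ (coeff p)) , (λ p → S.*-identityʳ (coeff p))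
      ; distrib    = (λ p q r → S.distribˡ (coeff p) (coeff q) (coeff r))
                   , (λ p q r → S.distribʳ (coeff p) (coeff q) (coeff r))
      }
    ; *-comm = λ p q → S.*-comm (coeff p) (coeff q)
    }

  polynomialRing : CommutativeRing (c ⊔ ℓ) ℓ
  polynomialRing = record { isCommutativeRing = isCommutativeRingₚ }

  *ₚ-almostCancelˡ : Decidable _≈_ → AlmostCancellative R → AlmostCancellative polynomialRing
  *ₚ-almostCancelˡ _≟_ cancel p q r =
    *ₛ-almostCancelˡ _≟_ cancel (coeff p) (coeff q) (coeff r)

module Fractions {c ℓ} (R : CommutativeRing c ℓ)
  (1≉0 : NonTrivial R) (cancel : AlmostCancellative R) where

  open CommutativeRing R hiding (zero)
  open Relation.Binary.Reasoning.Setoid setoid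
  open Algebra.Properties.Semiring.Exp semiring using (_^_)
  open import Algebra.Solver.Ring.NaturalCoefficients.Default commutativeSemiring
    using (solve; _:+_; _:*_; _:=_; con)

  infix 4 _≈ᶠ_
  infixl 6 _+ᶠ_
  infixl 7 _*ᶠ_

  record Fraction : Set (c ⊔ ℓ) where
    constructor frac
    field
      num   : Carrier
      den   : Carrier
      den≉0 : ¬ den ≈ 0#
  open Fraction public

  _≈ᶠ_ : Fraction → Fraction → Set ℓ
  x ≈ᶠ y = num x * den y ≈ num y * den x

  *-≉0 : ∀ {a b} → ¬ a ≈ 0# → ¬ b ≈ 0# → ¬ a * b ≈ 0#
  *-≉0 a≉0 b≉0 ab≈0 = b≉0 (cancel _ _ _ a≉0 (trans ab≈0 (sym (zeroʳ _))))

  ^-≉0 : ∀ {a} → ¬ a ≈ 0# → ∀ n → ¬ a ^ n ≈ 0#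
  ^-≉0 a≉0 zero    = 1≉0
  ^-≉0 a≉0 (suc n) = *-≉0 a≉0 (^-≉0 a≉0 n)

  _+ᶠ_ _*ᶠ_ : Fraction → Fraction → Fraction
  frac a b b≉0 +ᶠ frac c d d≉0 = frac (a * d + c * b) (b * d) (*-≉0 b≉0 d≉0)
  frac a b b≉0 *ᶠ frac c d d≉0 = frac (a * c) (b * d) (*-≉0 b≉0 d≉0)

  -ᶠ_ : Fraction → Fraction
  -ᶠ frac a b b≉0 = frac (- a) b b≉0

  embed : Carrier → Fraction
  embed a = frac a 1# 1≉0

  pow : ∀ a → ¬ a ≈ 0# → ℤ → Fraction
  pow a a≉0 (+ n)    = embed (a ^ n)
  pow a a≉0 -[1+ n ] = frac 1# (a ^ suc n) (^-≉0 a≉0 (suc n))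

  ≈ᶠ-trans : ∀ {x y z} → x ≈ᶠ y → y ≈ᶠ z → x ≈ᶠ z
  ≈ᶠ-trans {frac a b _} {frac c d d≉0} {frac e f _} ad≈cb cf≈ed = cancel d _ _ d≉0 (begin
    d * (a * f)  ≈⟨ solve 3 (λ d a f → d :* (a :* f) := (a :* d) :* f) refl d a f ⟩
    (a * d) * f  ≈⟨ *-congʳ ad≈cb ⟩
    (c * b) * f  ≈⟨ solve 3 (λ c b f → (c :* b) :* f := (c :* f) :* b) refl c b f ⟩
    (c * f) * b  ≈⟨ *-congʳ cf≈ed ⟩
    (e * d) * b  ≈⟨ solve 3 (λ e d b → (e :* d) :* b := d :* (e :* b)) refl e d b ⟩
    d * (e * b)  ∎)

  ≈ᶠ-isEquivalence : IsEquivalence _≈ᶠ_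
  ≈ᶠ-isEquivalence = record
    { refl  = refl
    ; sym   = sym
    ; trans = λ {x} {y} {z} → ≈ᶠ-trans {x} {y} {z}
    }

  +ᶠ-cong : ∀ {x x′ y y′} → x ≈ᶠ x′ → y ≈ᶠ y′ → x +ᶠ y ≈ᶠ x′ +ᶠ y′
  +ᶠ-cong {frac a b _} {frac a′ b′ _} {frac c d _} {frac c′ d′ _} p q = begin
    (a * d + c * b) * (b′ * d′)
      ≈⟨ solve 6 (λ a b c d b′ d′ → (a :* d :+ c :* b) :* (b′ :* d′)
                   := (a :* b′) :* (d :* d′) :+ (c :* d′) :* (b :* b′)) refl a b c d b′ d′ ⟩
    (a * b′) * (d * d′) + (c * d′) * (b * b′)
      ≈⟨ +-cong (*-congʳ p) (*-congʳ q) ⟩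
    (a′ * b) * (d * d′) + (c′ * d) * (b * b′)
      ≈⟨ solve 6 (λ a′ b c′ d b′ d′ → (a′ :* b) :* (d :* d′) :+ (c′ :* d) :* (b :* b′)
                   := (a′ :* d′ :+ c′ :* b′) :* (b :* d)) refl a′ b c′ d b′ d′ ⟩
    (a′ * d′ + c′ * b′) * (b * d) ∎

  *ᶠ-cong : ∀ {x x′ y y′} → x ≈ᶠ x′ → y ≈ᶠ y′ → x *ᶠ y ≈ᶠ x′ *ᶠ y′
  *ᶠ-cong {frac a b _} {frac a′ b′ _} {frac c d _} {frac c′ d′ _} p q = begin
    (a * c) * (b′ * d′)  ≈⟨ medial a c b′ d′ ⟩
    (a * b′) * (c * d′)  ≈⟨ *-cong p q ⟩
    (a′ * b) * (c′ * d)  ≈⟨ medial a′ b c′ d ⟩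
    (a′ * c′) * (b * d)  ∎
    where
    medial : ∀ a b c d → (a * b) * (c * d) ≈ (a * c) * (b * d)
    medial = solve 4 (λ a b c d → (a :* b) :* (c :* d) := (a :* c) :* (b :* d)) refl

  -ᶠ-cong : ∀ {x y} → x ≈ᶠ y → -ᶠ x ≈ᶠ -ᶠ y
  -ᶠ-cong {frac a b _} {frac c d _} p = begin
    - a * d    ≈⟨ -‿distribˡ-* a d ⟨
    - (a * d)  ≈⟨ -‿cong p ⟩
    - (c * b)  ≈⟨ -‿distribˡ-* c b ⟩
    - c * b    ∎
    where open Algebra.Properties.Ring ring using (-‿distribˡ-*)

  +ᶠ-comm : ∀ x y → x +ᶠ y ≈ᶠ y +ᶠ x
  +ᶠ-comm (frac a b _) (frac c d _) = *-cong (+-comm _ _) (*-comm _ _)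

  *ᶠ-comm : ∀ x y → x *ᶠ y ≈ᶠ y *ᶠ x
  *ᶠ-comm (frac a b _) (frac c d _) = *-cong (*-comm _ _) (*-comm _ _)

  +ᶠ-assoc : ∀ x y z → (x +ᶠ y) +ᶠ z ≈ᶠ x +ᶠ (y +ᶠ z)
  +ᶠ-assoc (frac a b _) (frac c d _) (frac e f _) =
    solve 6 (λ a b c d e f →
      ((a :* d :+ c :* b) :* f :+ e :* (b :* d)) :* (b :* (d :* f))
        := (a :* (d :* f) :+ (c :* f :+ e :* d) :* b) :* ((b :* d) :* f)) refl a b c d e f

  *ᶠ-assoc : ∀ x y z → (x *ᶠ y) *ᶠ z ≈ᶠ x *ᶠ (y *ᶠ z)
  *ᶠ-assoc (frac a b _) (frac c d _) (frac e f _) = *-cong (*-assoc _ _ _) (sym (*-assoc _ _ _))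

  +ᶠ-identityˡ : ∀ x → embed 0# +ᶠ x ≈ᶠ x
  +ᶠ-identityˡ (frac a b _) =
    solve 2 (λ a b → (con 0 :* b :+ a :* con 1) :* b := a :* (con 1 :* b)) refl a b

  *ᶠ-identityˡ : ∀ x → embed 1# *ᶠ x ≈ᶠ x
  *ᶠ-identityˡ (frac a b _) = solve 2 (λ a b → (con 1 :* a) :* b := a :* (con 1 :* b)) refl a b

  -ᶠ-inverseˡ : ∀ x → (-ᶠ x) +ᶠ x ≈ᶠ embed 0#
  -ᶠ-inverseˡ (frac a b _) = begin
    (- a * b + a * b) * 1#  ≈⟨ *-identityʳ _ ⟩
    - a * b + a * b         ≈⟨ distribʳ b (- a) a ⟨
    (- a + a) * b           ≈⟨ *-congʳ (-‿inverseˡ a) ⟩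
    0# * b                  ≈⟨ zeroˡ b ⟩
    0#                      ≈⟨ zeroˡ _ ⟨
    0# * (b * b)            ∎

  *ᶠ-distribˡ : ∀ x y z → x *ᶠ (y +ᶠ z) ≈ᶠ (x *ᶠ y) +ᶠ (x *ᶠ z)
  *ᶠ-distribˡ (frac a b _) (frac c d _) (frac e f _) =
    solve 6 (λ a b c d e f →
      (a :* (c :* f :+ e :* d)) :* ((b :* d) :* (b :* f))
        := ((a :* c) :* (b :* f) :+ (a :* e) :* (b :* d)) :* (b :* (d :* f))) refl a b c d e f

  *ᶠ-distribʳ : ∀ x y z → (y +ᶠ z) *ᶠ x ≈ᶠ (y *ᶠ x) +ᶠ (z *ᶠ x)
  *ᶠ-distribʳ (frac a b _) (frac c d _) (frac e f _) =
    solve 6 (λ a b c d e f →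
      ((c :* f :+ e :* d) :* a) :* ((d :* b) :* (f :* b))
        := ((c :* a) :* (f :* b) :+ (e :* a) :* (d :* b)) :* ((d :* f) :* b)) refl a b c d e f

  isCommutativeRingᶠ : IsCommutativeRing _≈ᶠ_ _+ᶠ_ _*ᶠ_ -ᶠ_ (embed 0#) (embed 1#)
  isCommutativeRingᶠ = record
    { isRing = record
      { +-isAbelianGroup = record
        { isGroup = record
          { isMonoid = record
            { isSemigroup = record
              { isMagma = record
                { isEquivalence = ≈ᶠ-isEquivalence
                ; ∙-cong = λ {x} {x′} {y} {y′} → +ᶠ-cong {x} {x′} {y} {y′}
                }
              ; assoc = +ᶠ-assoc
              }
            ; identity = +ᶠ-identityˡ
                       , λ x → ≈ᶠ-trans {x +ᶠ embed 0#} {embed 0# +ᶠ x} {x}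
                           (+ᶠ-comm x (embed 0#)) (+ᶠ-identityˡ x)
            }
          ; inverse = -ᶠ-inverseˡ
                    , λ x → ≈ᶠ-trans {x +ᶠ (-ᶠ x)} {(-ᶠ x) +ᶠ x} {embed 0#}
                        (+ᶠ-comm x (-ᶠ x)) (-ᶠ-inverseˡ x)
          ; ⁻¹-cong = λ {x} {y} → -ᶠ-cong {x} {y}
          }
        ; comm = +ᶠ-comm
        }
      ; *-cong     = λ {x} {x′} {y} {y′} → *ᶠ-cong {x} {x′} {y} {y′}
      ; *-assoc    = *ᶠ-assoc
      ; *-identity = *ᶠ-identityˡ
                   , λ x → ≈ᶠ-trans {x *ᶠ embed 1#} {embed 1# *ᶠ x} {x}
                       (*ᶠ-comm x (embed 1#)) (*ᶠ-identityˡ x)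
      ; distrib    = *ᶠ-distribˡ , *ᶠ-distribʳ
      }
    ; *-comm = *ᶠ-comm
    }

  fractionRing : CommutativeRing (c ⊔ ℓ) ℓ
  fractionRing = record { isCommutativeRing = isCommutativeRingᶠ }

ℚ-ring ℚ[x] ℚ[x]⟦t⟧ ℚ⟮x⟯ : CommutativeRing 0ℓ 0ℓ

ℚ-ring = ℚₚ.+-*-commutativeRing

open Polynomials ℚ-ring using (Polynomial; constₚ; X; _≈ₚ_; 0ₚ; _*ₚ_; *ₚ-almostCancelˡ)

ℚ[x] = Polynomials.polynomialRing ℚ-ring

ℚ[x]⟦t⟧ = PowerSeries.seriesRing ℚ[x]

ℚ-almostCancelˡ : AlmostCancellative ℚ-ring
ℚ-almostCancelˡ p q r p≢0 pq≡pr = begin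
  q                    ≡⟨ unit q ⟨
  1/p ℚ.* (p ℚ.* q)    ≡⟨ ≡.cong (1/p ℚ.*_) pq≡pr ⟩
  1/p ℚ.* (p ℚ.* r)    ≡⟨ unit r ⟩
  r                    ∎
  where
  open ≡.≡-Reasoning
  instance _ = ℚ.≢-nonZero p≢0

  1/p : ℚ
  1/p = ℚ.1/ p

  unit : ∀ s → 1/p ℚ.* (p ℚ.* s) ≡ s
  unit s = begin
    1/p ℚ.* (p ℚ.* s)  ≡⟨ ℚₚ.*-assoc 1/p p s ⟨
    1/p ℚ.* p ℚ.* s    ≡⟨ ≡.cong (ℚ._* s) (ℚₚ.*-inverseˡ p) ⟩
    1ℚ ℚ.* s           ≡⟨ ℚₚ.*-identityˡ s ⟩
    s                  ∎

open Fractions ℚ[x] (λ 1≈0 → case 1≈0 0 of λ ())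
  (*ₚ-almostCancelˡ ℚₚ._≟_ ℚ-almostCancelˡ) using (embed; pow; fractionRing)

ℚ⟮x⟯ = fractionRing

RationalFunction : Set
RationalFunction = CommutativeRing.Carrier ℚ⟮x⟯

X≉0 : ¬ X ≈ₚ 0ₚ
X≉0 X≈0 = case X≈0 1 of λ ()

infixr 8 x^_

x^_ : ℤ → RationalFunction
x^_ = pow X X≉0

fromPolynomial : Polynomial → RationalFunction
fromPolynomial = embed

fromℚ : ℚ → RationalFunction
fromℚ q = fromPolynomial (constₚ q)

ℕ→ℚ : ℕ → ℚ
ℕ→ℚ n = + n ℚ./ 1

fromℕ : ℕ → RationalFunction
fromℕ n = fromℚ (ℕ→ℚ n)

private
  constantTerm : ∀ {c ℓ} (R : CommutativeRing c ℓ) (let open CommutativeRing R) →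
                 ∀ a → 1# - (a * 0# + 0#) + (0# * 0# + 0#) ≈ 1#
  constantTerm R a = begin
    1# - (a * 0# + 0#) + (0# * 0# + 0#)
      ≈⟨ +-cong (+-congˡ (-‿cong (trans (+-identityʳ _) (zeroʳ a))))
                (trans (+-identityʳ _) (zeroʳ 0#)) ⟩
    1# - 0# + 0#  ≈⟨ +-identityʳ _ ⟩
    1# - 0#       ≈⟨ +-congˡ -0#≈0# ⟩
    1# + 0#       ≈⟨ +-identityʳ _ ⟩
    1#            ∎
    where
    open CommutativeRing R
    open Algebra.Properties.Ring ring using (-0#≈0#)
    open Relation.Binary.Reasoning.Setoid setoid

module _ where
  open CommutativeRing ℚ[x]⟦t⟧
  open Algebra.Properties.Semiring.Exp semiring using (_^_)
  open PowerSeries ℚ[x] using (Series; const; _÷ₛ_; ÷ₛ-*) renaming (var to t)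

  -- The generating function (1 - t²)/(1 - 2xt + t²); its coefficient T n is
  -- twice the classical Chebyshev polynomial when n ≥ 1.
  chebyshevNum chebyshevDen chebyshevGF : Series
  chebyshevNum = 1# - t * t
  chebyshevDen = 1# - const (constₚ (ℕ→ℚ 2) *ₚ X) * t + t * t
  chebyshevGF  = chebyshevNum ÷ₛ chebyshevDen

  T : ℕ → Polynomial
  T n = chebyshevGF n

  T⟨_⟩ : ℕ → ℕ → Polynomial
  T⟨ α ⟩ n = (chebyshevGF ^ α) n

  chebyshevGF-spec : chebyshevGF * chebyshevDen ≈ chebyshevNum
  chebyshevGF-spec = ÷ₛ-* chebyshevNum chebyshevDen (constantTerm ℚ[x] (constₚ (ℕ→ℚ 2) *ₚ X))

-- (y)ₙ = y (y - 1) ⋯ (y - n + 1)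
falling : ℚ → ℕ → ℚ
falling y zero    = 1ℚ
falling y (suc n) = y ℚ.* falling (y ℚ.- 1ℚ) n

-- (2k - 1)!!
oddDoubleFactorial : ℕ → ℕ
oddDoubleFactorial zero    = 1
oddDoubleFactorial (suc k) = (2 ℕ.* k ℕ.+ 1) ℕ.* oddDoubleFactorial k

-- nestedSum r M F [] is the sum of F (k₁ ∷ ⋯ ∷ kᵣ ∷ []) over 0 ≤ kᵣ ≤ M,
-- 0 ≤ kᵣ₋₁ ≤ M - kᵣ, …, 0 ≤ k₁ ≤ M - kᵣ - ⋯ - k₂; the last argument
-- accumulates the indices already chosen, the most recent one first.
nestedSum : ℕ → ℕ → (List ℕ → ℚ) → List ℕ → ℚ
nestedSum zero    M F ks = F ks
nestedSum (suc r) M F ks = ∑[ 0 ≤ k ≤ M ] nestedSum r (M ∸ k) F (k ∷ ks)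
  where open Sums ℚ-ring

-- ∏ (N - (kⱼ + ⋯ + kᵢ₋₁) - (2i + 2 - j)/2)_{kⱼ₋₁}, the product running from
-- the given j up to i, where the list is kⱼ₋₁ ∷ kⱼ ∷ ⋯ ∷ kᵢ₋₁ ∷ [].
fallingProduct : (i N j : ℕ) → List ℕ → ℚ
fallingProduct i N j []       = 1ℚ
fallingProduct i N j (k ∷ ks) =
  falling (ℕ→ℚ N ℚ.- ℕ→ℚ (ListAction.sum ks) ℚ.- (+ (2 ℕ.* i ℕ.+ 2 ∸ j) ℚ./ 2)) k
    ℚ.* fallingProduct i N (suc j) ks

-- Meaningful for 1 ≤ i ≤ N only, which also makes each ∸ an honest subtraction.
a : (i N : ℕ) → ℚ
a zero              N = 0ℚ
a (suc zero)        N = ℕ→ℚ (oddDoubleFactorial (N ∸ 1))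
a i@(suc (suc i-2)) N = nestedSum (suc i-2) (N ∸ i) term []
  where
  term : List ℕ → ℚ
  term ks = ℕ→ℚ (2 ℕ.^ ListAction.sum ks)
    ℚ.* fallingProduct i N 2 ks
    ℚ.* ℕ→ℚ (oddDoubleFactorial (N ∸ i ∸ ListAction.sum ks))

_!/_! : ℕ → ℕ → ℚ
i !/ l ! = (+ (i !) ℚ./ (l !)) {{l !≢0}}

{-# OPTIONS --safe #-}

-- Put F = 1/(1 - 2xt + t²), G = (1 - t²) F, V = 1/(x - t) and D = d/dt.  The identity
-- compares coefficients of tⁿ in 2 · 2ᴺ N! Fᴺ⁺¹, which is computed in two ways.
-- First, Fᴺ⁺¹ = (1 - t)⁻⁽ᴺ⁺¹⁾ (1 + t)⁻⁽ᴺ⁺¹⁾ Gᴺ⁺¹.  Secondly, D F = 2 (x - t) F² says that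
-- δ = V D satisfies δ Fᵏ = 2k Fᵏ⁺¹, so that 2ᴺ N! Fᴺ⁺¹ = δᴺ F; expanding δᴺ F gives
-- Σᵢ aᵢ(N) V²ᴺ⁻ⁱ DⁱF, where 2F = G/(1 - t) + G/(1 + t) and Leibniz' rule applies to
-- both summands.
-- Both expansions are sums over lattice paths: if
-- δ (W r m) = α r m · W r (m + 1) + W (r + 1) m, then the coefficient of W r m in
-- δʳ⁺ᵐ (W 0 0) is the number of paths from (0, 0) to (r, m) weighted by α.  These numbers
-- are aᵢ(N) for the operator V D and i!/l! for Leibniz' rule.
module Submission where

open import Defs
open import Algebra.Bundles using (CommutativeRing)
open import Algebra.Morphism.Structures using (IsRingHomomorphism)
import Algebra.Properties.CommutativeMonoid.Mult
import Algebra.Properties.CommutativeSemiring.Exp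
import Algebra.Properties.Group
import Algebra.Properties.Ring
import Algebra.Properties.Semiring.Exp
import Algebra.Properties.Semiring.Mult
import Algebra.Properties.Semiring.Sum
open import Data.Fin.Base using (toℕ)
open import Data.Fin.Properties using (toℕ<n)
open import Data.Integer.Base as ℤ using (ℤ; +_; -[1+_]) renaming (_-_ to _-ℤ_)
import Data.Integer.Properties as ℤₚ
import Data.Integer.Tactic.RingSolver as ℤ-Solver
open import Data.List.Base using (List; []; _∷_)
open import Data.Nat.Base as ℕ using (ℕ; zero; suc; _∸_; _≤_; _!)
  renaming (_+_ to _+ℕ_; _*_ to _*ℕ_; _^_ to _^ℕ_)
open import Data.Nat.Combinatorics using (_C_; nCn≡1; nCk+nC[k+1]≡[n+1]C[k+1])
open import Data.Nat.GeneralisedArithmetic using (fold)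
import Data.Nat.ListAction as ListAction
import Data.Nat.Properties as ℕₚ
import Data.Nat.Tactic.RingSolver as ℕ-Solver
open import Data.Rational.Base as ℚ using (ℚ; 0ℚ; 1ℚ)
import Data.Rational.Properties as ℚₚ
import Data.Rational.Solver as ℚ-Solver
open import Data.Rational.Unnormalised.Base as ℚᵘ using (mkℚᵘ; *≡*)
import Data.Rational.Unnormalised.Properties as ℚᵘₚ
open import Function.Base using (_∘_)
open import Level using (_⊔_)
open import Relation.Binary.PropositionalEquality as ≡ using (_≡_)
import Relation.Binary.Reasoning.Setoid

-- Why the path counts are the numbers `a`: with `i = r + 1` and `N = r + m + 1`, the index `k_j` in
-- the definition of `a` is the number of vertical steps made in column `j`, for `1 ≤ j < i`, and
-- the double factorial weighs column 0. Within a column the rates drop by 2 from one step to the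
-- next lower one, so `k` steps contribute `2^k (y)_k` with `2y` the top rate. This is the origin of
-- the powers of 2 and of the half-integral arguments. The index `i` starts at 1 because the paths
-- start at `δF = V D F` and not at `F`.
--
-- `V = x⁻¹ / (1 - x⁻¹ t)` needs an inverse of `x`, while `T` is defined over `ℚ[x]`. The
-- calculation is therefore done over an arbitrary commutative ring in which `x` is invertible and
-- some series satisfies the defining equation of `G`; the Chebyshev series is then mapped
-- coefficientwise to `ℚ⟮x⟯`. There is no division of series in it: `1/(1 - t)`, `1/(1 + t)` and
-- `1/(1 - x⁻¹ t)` are explicit series proved to be inverses, and `F` is the product of the first
-- two with `G`. Coefficients act by repeated addition and become rational constants only at the
-- end.

-- The number of lattice paths from (0, 0) to (r, m), where a horizontal step
-- counts once and the vertical step (r, m) → (r, m + 1) counts α r m times.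
weight : (ℕ → ℕ → ℕ) → ℕ → ℕ → ℕ
weight α zero    zero    = 1
weight α zero    (suc m) = α 0 m ℕ.* weight α 0 m
weight α (suc r) zero    = weight α r 0
weight α (suc r) (suc m) = α (suc r) m ℕ.* weight α (suc r) m ℕ.+ weight α r (suc m)

-- For `A = 1/(1 - e t)` the derivative of `A^(k+1)` is `(k+1) e A^(k+2)`; here `k` counts the
-- derivatives that fell on `A` and `l` those that fell on the other factor.
leibnizRate : ℕ → ℕ → ℕ
leibnizRate l k = suc k

-- This is `2N - i`: at once the exponent of `V` at the point `(r, m)` and the factor that `D`
-- brings down from that power. Since `D V = V²`, a vertical step raises the exponent by 2 and a
-- horizontal step by 1.
odeRate : ℕ → ℕ → ℕ
odeRate r m = suc (2 ℕ.* m ℕ.+ r)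

-- Weighted sums along antidiagonals and additive operators.

module DiagonalSums {c ℓ} (S : CommutativeRing c ℓ) where
  open CommutativeRing S hiding (zero)
  open Sums S
  open Algebra.Properties.Semiring.Sum semiring using (*-distribˡ-sum; ∑-distrib-+)
  open Algebra.Properties.Semiring.Mult semiring
  open Algebra.Properties.CommutativeMonoid.Mult +-commutativeMonoid using (×-distrib-+)
  open Relation.Binary.Reasoning.Setoid setoid
  private module G = Algebra.Properties.Group +-group

  diagonal : ℕ → (ℕ → ℕ → Carrier) → Carrier
  diagonal n f = ∑[ 0 ≤ r ≤ n ] f r (n ∸ r)

  diagonal-cong : ∀ n {f g} → (∀ r m → f r m ≈ g r m) → diagonal n f ≈ diagonal n g
  diagonal-cong n f≈g = sum-cong-≋ {suc n} λ r → f≈g (toℕ r) (n ∸ toℕ r)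

  diagonal-+ : ∀ n f g → diagonal n (λ r m → f r m + g r m) ≈ diagonal n f + diagonal n g
  diagonal-+ n f g = ∑-distrib-+ {suc n} (λ r → f (toℕ r) (n ∸ toℕ r)) (λ r → g (toℕ r) (n ∸ toℕ r))

  *-distribˡ-diagonal : ∀ n x f → x * diagonal n f ≈ diagonal n (λ r m → x * f r m)
  *-distribˡ-diagonal n x f = *-distribˡ-sum {suc n} x (λ r → f (toℕ r) (n ∸ toℕ r))

  diagonal-last : ∀ n f → diagonal (suc n) f ≈ diagonal n (λ r m → f r (suc m)) + f (suc n) 0
  diagonal-last zero    f = sym (trans (+-assoc _ _ _) (+-congˡ (+-comm _ _)))
  diagonal-last (suc n) f = begin
    f 0 (2 ℕ.+ n) + diagonal (suc n) (λ r → f (suc r))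
      ≈⟨ +-congˡ (diagonal-last n (λ r → f (suc r))) ⟩
    f 0 (2 ℕ.+ n) + (diagonal n (λ r m → f (suc r) (suc m)) + f (2 ℕ.+ n) 0)
      ≈⟨ +-assoc _ _ _ ⟨
    diagonal (suc n) (λ r m → f r (suc m)) + f (2 ℕ.+ n) 0 ∎

  module _ (α : ℕ → ℕ → ℕ) where

    private
      w = weight α

    -- The last step of a path ending on antidiagonal `n + 1` is vertical or horizontal; regrouping
    -- the paths by the point from which that step departs gives a sum over antidiagonal `n`.
    diagonal-weight-suc : ∀ n (W : ℕ → ℕ → Carrier) →
      diagonal (suc n) (λ r m → w r m × W r m) ≈
      diagonal n (λ r m → w r m × (α r m × W r (suc m) + W (suc r) m))
    diagonal-weight-suc n W = begin
      w 0 (suc n) × W 0 (suc n) + diagonal n (λ r m → w (suc r) m × W (suc r) m)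
        ≈⟨ +-congˡ (diagonal-cong n split) ⟩
      up 0 (suc n) + diagonal n (λ r m → up (suc r) m + across r m)
        ≈⟨ +-congˡ (diagonal-+ n (λ r → up (suc r)) across) ⟩
      up 0 (suc n) + (diagonal n (λ r → up (suc r)) + diagonal n across)
        ≈⟨ +-assoc _ _ _ ⟨
      diagonal (suc n) up + diagonal n across
        ≈⟨ +-congʳ (trans (diagonal-last n up) (+-identityʳ _)) ⟩
      diagonal n (λ r m → up r (suc m)) + diagonal n across
        ≈⟨ diagonal-+ n (λ r m → up r (suc m)) across ⟨
      diagonal n (λ r m → up r (suc m) + across r m)
        ≈⟨ diagonal-cong n collect ⟩
      diagonal n (λ r m → w r m × (α r m × W r (suc m) + W (suc r) m)) ∎
      where
      -- Arrivals by a vertical and by a horizontal step. The value 0 of `up` at height 0, where no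
      -- vertical step arrives, lets `diagonal-last` drop that end of the sum.
      up across : ℕ → ℕ → Carrier
      up r zero    = 0#
      up r (suc m) = (α r m ℕ.* w r m) × W r (suc m)
      across r m   = w r m × W (suc r) m

      split : ∀ r m → w (suc r) m × W (suc r) m ≈ up (suc r) m + across r m
      split r zero    = sym (+-identityˡ _)
      split r (suc m) = ×-homo-+ _ (α (suc r) m ℕ.* w (suc r) m) (w r (suc m))

      collect : ∀ r m → up r (suc m) + across r m ≈ w r m × (α r m × W r (suc m) + W (suc r) m)
      collect r m = begin
        (α r m ℕ.* w r m) × W r (suc m) + across r m
          ≈⟨ +-congʳ (×-congˡ (ℕₚ.*-comm (α r m) (w r m))) ⟩
        (w r m ℕ.* α r m) × W r (suc m) + across r m
          ≈⟨ +-congʳ (×-assocˡ _ (w r m) (α r m)) ⟨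
        w r m × (α r m × W r (suc m)) + across r m
          ≈⟨ ×-distrib-+ _ _ (w r m) ⟨
        w r m × (α r m × W r (suc m) + W (suc r) m) ∎

  module Operator (δ : Carrier → Carrier)
    (δ-cong : ∀ {x y} → x ≈ y → δ x ≈ δ y)
    (δ-+ : ∀ x y → δ (x + y) ≈ δ x + δ y) where

    δ-0# : δ 0# ≈ 0#
    δ-0# = G.identityʳ-unique (δ 0#) (δ 0#)
      (trans (sym (δ-+ 0# 0#)) (δ-cong (+-identityʳ 0#)))

    δ-× : ∀ n x → δ (n × x) ≈ n × δ x
    δ-× zero    x = δ-0#
    δ-× (suc n) x = trans (δ-+ x (n × x)) (+-congˡ (δ-× n x))

    δ-sum : ∀ n (f : ℕ → Carrier) → δ (sum {n} (λ i → f (toℕ i))) ≈ sum {n} (λ i → δ (f (toℕ i)))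
    δ-sum zero    f = δ-0#
    δ-sum (suc n) f = trans (δ-+ _ _) (+-congˡ (δ-sum n (λ i → f (suc i))))

    fold-cong : ∀ n {x y} → x ≈ y → fold x δ n ≈ fold y δ n
    fold-cong zero    x≈y = x≈y
    fold-cong (suc n) x≈y = δ-cong (fold-cong n x≈y)

    fold-+ : ∀ n x y → fold (x + y) δ n ≈ fold x δ n + fold y δ n
    fold-+ zero    x y = refl
    fold-+ (suc n) x y = trans (δ-cong (fold-+ n x y)) (δ-+ _ _)

    -- Each application of δ extends the lattice paths by one step.
    δ^-weight : ∀ α (W : ℕ → ℕ → Carrier) → (∀ r m → δ (W r m) ≈ α r m × W r (suc m) + W (suc r) m) →
      ∀ n → fold (W 0 0) δ n ≈ diagonal n (λ r m → weight α r m × W r m)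
    δ^-weight α W step zero    = sym (trans (+-identityʳ _) (×-homo-1 _))
    δ^-weight α W step (suc n) = begin
      δ (fold (W 0 0) δ n)
        ≈⟨ δ-cong (δ^-weight α W step n) ⟩
      δ (diagonal n (λ r m → weight α r m × W r m))
        ≈⟨ δ-sum (suc n) (λ r → weight α r (n ∸ r) × W r (n ∸ r)) ⟩
      diagonal n (λ r m → δ (weight α r m × W r m))
        ≈⟨ diagonal-cong n (λ r m → trans (δ-× (weight α r m) _) (×-congʳ (weight α r m) (step r m))) ⟩
      diagonal n (λ r m → weight α r m × (α r m × W r (suc m) + W (suc r) m))
        ≈⟨ diagonal-weight-suc α n W ⟨
      diagonal (suc n) (λ r m → weight α r m × W r m) ∎

-- Derivations: reciprocals, Leibniz' rule and powers of `V D`.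

record Derivation {c ℓ} (S : CommutativeRing c ℓ) : Set (c ⊔ ℓ) where
  open CommutativeRing S
  field
    D      : Carrier → Carrier
    D-cong : ∀ {x y} → x ≈ y → D x ≈ D y
    D-+    : ∀ x y → D (x + y) ≈ D x + D y
    D-*    : ∀ x y → D (x * y) ≈ D x * y + x * D y

module Derivations {c ℓ} (S : CommutativeRing c ℓ) (derivation : Derivation S) where
  open CommutativeRing S
  open Derivation derivation
  open DiagonalSums S
  open Algebra.Properties.Semiring.Mult semiring
  open Algebra.Properties.CommutativeSemiring.Exp commutativeSemiring
  open import Algebra.Solver.Ring.NaturalCoefficients.Default commutativeSemiring
    using (solve; _:*_; _:=_)
  open Relation.Binary.Reasoning.Setoid setoid
  private module G = Algebra.Properties.Group +-group
  open Operator D D-cong D-+ public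
    using (fold-cong; fold-+)
    renaming (δ-0# to D-0#)

  D-1# : D 1# ≈ 0#
  D-1# = G.identityʳ-unique (D 1#) (D 1#) (begin
    D 1# + D 1#            ≈⟨ +-cong (sym (*-identityʳ _)) (sym (*-identityˡ _)) ⟩
    D 1# * 1# + 1# * D 1#  ≈⟨ D-* 1# 1# ⟨
    D (1# * 1#)            ≈⟨ D-cong (*-identityʳ 1#) ⟩
    D 1#                   ∎)

  D-‿ : ∀ x → D (- x) ≈ - D x
  D-‿ x = G.inverseˡ-unique (D (- x)) (D x)
    (trans (sym (D-+ (- x) x)) (trans (D-cong (-‿inverseˡ x)) D-0#))

  D-^ : ∀ x n → D (x ^ suc n) ≈ suc n × (x ^ n * D x)
  D-^ x zero    = begin
    D (x * 1#)           ≈⟨ D-cong (*-identityʳ x) ⟩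
    D x                  ≈⟨ *-identityˡ _ ⟨
    1# * D x             ≈⟨ ×-homo-1 _ ⟨
    1 × (1# * D x)       ∎
  D-^ x (suc n) = begin
    D (x * x ^ suc n)
      ≈⟨ D-* _ _ ⟩
    D x * x ^ suc n + x * D (x ^ suc n)
      ≈⟨ +-cong (*-comm _ _) (*-congˡ (D-^ x n)) ⟩
    x ^ suc n * D x + x * (suc n × (x ^ n * D x))
      ≈⟨ +-congˡ (trans (×-comm-* (suc n) x _) (×-congʳ (suc n) (sym (*-assoc _ _ _)))) ⟩
    (2 ℕ.+ n) × (x ^ suc n * D x) ∎

  -- Differentiating `f * g = 1` gives `D f * g = - f * D g`, and one more factor `f` isolates
  -- `D f`. Here `h` is `- D g`: for `g` equal to `1 - e t`, `x - t` and `1 - 2xt + t²` it is `e`,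
  -- `1` and `2(x - t)`, so no signs remain.
  D-inverse : ∀ {f g h} → f * g ≈ 1# → D g + h ≈ 0# → D f ≈ h * (f * f)
  D-inverse {f} {g} {h} fg≈1 Dg+h≈0 = begin
    D f                ≈⟨ *-identityʳ _ ⟨
    D f * 1#           ≈⟨ *-congˡ fg≈1 ⟨
    D f * (f * g)      ≈⟨ solve 3 (λ x f g → x :* (f :* g) := f :* (x :* g)) refl (D f) f g ⟩
    f * (D f * g)      ≈⟨ *-congˡ (G.∙-cancelʳ (f * D g) _ _ (trans sum≈0 (sym sum′≈0))) ⟩
    f * (f * h)        ≈⟨ solve 2 (λ f h → f :* (f :* h) := h :* (f :* f)) refl f h ⟩
    h * (f * f)        ∎
    where
    sum≈0 : D f * g + f * D g ≈ 0#
    sum≈0 = trans (sym (D-* f g)) (trans (D-cong fg≈1) D-1#)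

    sum′≈0 : f * h + f * D g ≈ 0#
    sum′≈0 = begin
      f * h + f * D g  ≈⟨ distribˡ f h (D g) ⟨
      f * (h + D g)    ≈⟨ *-congˡ (trans (+-comm _ _) Dg+h≈0) ⟩
      f * 0#           ≈⟨ zeroʳ f ⟩
      0#               ∎

  D-constant-* : ∀ {e} → D e ≈ 0# → ∀ x → D (e * x) ≈ e * D x
  D-constant-* {e} De≈0 x = begin
    D (e * x)            ≈⟨ D-* e x ⟩
    D e * x + e * D x    ≈⟨ +-congʳ (trans (*-congʳ De≈0) (zeroˡ x)) ⟩
    0# + e * D x         ≈⟨ +-identityˡ _ ⟩
    e * D x              ∎

  D-constant-^ : ∀ {e} → D e ≈ 0# → ∀ n → D (e ^ n) ≈ 0#
  D-constant-^ De≈0 zero    = D-1#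
  D-constant-^ {e} De≈0 (suc n) = trans (D-constant-* De≈0 (e ^ n))
    (trans (*-congˡ (D-constant-^ De≈0 n)) (zeroʳ e))

  -- Since `D^k A = k! e^k A^(k+1)`, the binomial coefficient of Leibniz' rule merges with `k!` into
  -- the single factor `i!/l!`, which appears here as a path count.
  D^-product : ∀ {e A} → D e ≈ 0# → D A ≈ e * (A * A) → ∀ G i →
    fold (A * G) D i ≈
    diagonal i (λ l k → weight leibnizRate l k × (e ^ k * (A ^ suc k * fold G D l)))
  D^-product {e} {A} De≈0 DA G i = begin
    fold (A * G) D i
      ≈⟨ fold-cong i (trans (*-identityˡ _) (*-congʳ (*-identityʳ A))) ⟨
    fold (W 0 0) D i
      ≈⟨ δ^-weight leibnizRate W step i ⟩
    diagonal i (λ l k → weight leibnizRate l k × W l k) ∎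
    where
    open Operator D D-cong D-+ using (δ^-weight)

    W : ℕ → ℕ → Carrier
    W l k = e ^ k * (A ^ suc k * fold G D l)

    step : ∀ l k → D (W l k) ≈ suc k × W l (suc k) + W (suc l) k
    step l k = begin
      D (e ^ k * (A ^ suc k * g))
        ≈⟨ D-constant-* (D-constant-^ De≈0 k) _ ⟩
      e ^ k * D (A ^ suc k * g)
        ≈⟨ *-congˡ (D-* _ g) ⟩
      e ^ k * (D (A ^ suc k) * g + A ^ suc k * D g)
        ≈⟨ distribˡ _ _ _ ⟩
      e ^ k * (D (A ^ suc k) * g) + W (suc l) k
        ≈⟨ +-congʳ (*-congˡ (*-congʳ (trans (D-^ A k) (×-congʳ (suc k) (*-congˡ DA))))) ⟩
      e ^ k * ((suc k × (A ^ k * (e * (A * A)))) * g) + W (suc l) k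
        ≈⟨ +-congʳ (trans (*-congˡ (×-assoc-* (suc k) _ g)) (×-comm-* (suc k) (e ^ k) _)) ⟩
      suc k × (e ^ k * (A ^ k * (e * (A * A)) * g)) + W (suc l) k
        ≈⟨ +-congʳ (×-congʳ (suc k) (solve 5 (λ E P e A g →
             E :* (P :* (e :* (A :* A)) :* g) := e :* E :* (A :* (A :* P) :* g))
             refl (e ^ k) (A ^ k) e A g)) ⟩
      suc k × W l (suc k) + W (suc l) k ∎
      where
      g = fold G D l

  -- Both sides evaluate `δ^n (W 0 0)`, where `W 0 0` is already `δ F`. Hence `n` stands for
  -- `N - 1`, and only derivatives of `F` of order at least 1 occur.
  ^-higherDerivatives : ∀ {V F} → D V ≈ V * V → V * D F ≈ 2 × (F * F) → ∀ n →
    (2 ℕ.^ suc n ℕ.* suc n !) × F ^ (2 ℕ.+ n) ≈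
    diagonal n (λ r m → weight odeRate r m × (V ^ odeRate r m * fold F D (suc r)))
  ^-higherDerivatives {V} {F} DV VDF n = begin
    (2 ℕ.^ suc n ℕ.* suc n !) × F ^ (2 ℕ.+ n)
      ≈⟨ powers n ⟨
    fold (W 0 0) δ n
      ≈⟨ δ^-weight odeRate W step n ⟩
    diagonal n (λ r m → weight odeRate r m × W r m) ∎
    where
    δ : Carrier → Carrier
    δ x = V * D x

    open Operator δ (λ x≈y → *-congˡ (D-cong x≈y))
      (λ x y → trans (*-congˡ (D-+ x y)) (distribˡ V (D x) (D y)))
      using (δ-×; δ^-weight)

    W : ℕ → ℕ → Carrier
    W r m = V ^ odeRate r m * fold F D (suc r)

    odeRate-sucʳ : ∀ r m → 3 ℕ.+ (2 ℕ.* m ℕ.+ r) ≡ 1 ℕ.+ (2 ℕ.* suc m ℕ.+ r)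
    odeRate-sucʳ = ℕ-Solver.solve-∀

    odeRate-sucˡ : ∀ r m → 2 ℕ.+ (2 ℕ.* m ℕ.+ r) ≡ 1 ℕ.+ (2 ℕ.* m ℕ.+ suc r)
    odeRate-sucˡ = ℕ-Solver.solve-∀

    step : ∀ r m → δ (W r m) ≈ odeRate r m × W r (suc m) + W (suc r) m
    step r m = begin
      V * D (V ^ odeRate r m * g)
        ≈⟨ *-congˡ (D-* _ g) ⟩
      V * (D (V ^ odeRate r m) * g + V ^ odeRate r m * D g)
        ≈⟨ *-congˡ (+-congʳ (*-congʳ (trans (D-^ V p) (×-congʳ (odeRate r m) (*-congˡ DV))))) ⟩
      V * ((odeRate r m × (V ^ p * (V * V))) * g + V ^ odeRate r m * D g)
        ≈⟨ distribˡ V _ _ ⟩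
      V * ((odeRate r m × (V ^ p * (V * V))) * g) + V * (V ^ odeRate r m * D g)
        ≈⟨ +-cong (trans (*-congˡ (×-assoc-* (odeRate r m) _ g)) (×-comm-* (odeRate r m) V _))
                  (sym (*-assoc _ _ _)) ⟩
      odeRate r m × (V * (V ^ p * (V * V) * g)) + V ^ suc (odeRate r m) * D g
        ≈⟨ +-congʳ (×-congʳ (odeRate r m) (solve 3 (λ V P g →
             V :* (P :* (V :* V) :* g) := V :* (V :* (V :* P)) :* g) refl V (V ^ p) g)) ⟩
      odeRate r m × (V ^ (2 ℕ.+ odeRate r m) * g) + V ^ suc (odeRate r m) * D g
        ≈⟨ +-cong (×-congʳ (odeRate r m) (*-congʳ (^-congʳ V (odeRate-sucʳ r m))))
                  (*-congʳ (^-congʳ V (odeRate-sucˡ r m))) ⟩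
      odeRate r m × W r (suc m) + W (suc r) m ∎
      where
      p = 2 ℕ.* m ℕ.+ r
      g = fold F D (suc r)

    factor : ∀ n → (2 ℕ.^ suc n ℕ.* suc n !) ℕ.* ((2 ℕ.+ n) ℕ.* 2) ≡ 2 ℕ.^ (2 ℕ.+ n) ℕ.* (2 ℕ.+ n) !
    factor n = lemma (2 ℕ.^ n) (n !) n
      where
      lemma : ∀ a b n → ((2 ℕ.* a) ℕ.* (b ℕ.+ n ℕ.* b)) ℕ.* ((2 ℕ.+ n) ℕ.* 2) ≡
                        (2 ℕ.* (2 ℕ.* a)) ℕ.* ((2 ℕ.+ n) ℕ.* (b ℕ.+ n ℕ.* b))
      lemma = ℕ-Solver.solve-∀

    powers : ∀ n → fold (W 0 0) δ n ≈ (2 ℕ.^ suc n ℕ.* suc n !) × F ^ (2 ℕ.+ n)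
    powers zero    = begin
      V ^ 1 * D F          ≈⟨ *-congʳ (*-identityʳ V) ⟩
      V * D F              ≈⟨ VDF ⟩
      2 × (F * F)          ≈⟨ ×-congʳ 2 (*-congˡ (sym (*-identityʳ F))) ⟩
      2 × F ^ 2            ∎
    powers (suc n) = begin
      δ (fold (W 0 0) δ n)
        ≈⟨ *-congˡ (D-cong (powers n)) ⟩
      δ (q × F ^ (2 ℕ.+ n))
        ≈⟨ δ-× q _ ⟩
      q × (V * D (F ^ (2 ℕ.+ n)))
        ≈⟨ ×-congʳ q (*-congˡ (D-^ F (suc n))) ⟩
      q × (V * ((2 ℕ.+ n) × (F ^ suc n * D F)))
        ≈⟨ ×-congʳ q (×-comm-* (2 ℕ.+ n) V _) ⟩
      q × ((2 ℕ.+ n) × (V * (F ^ suc n * D F)))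
        ≈⟨ ×-congʳ q (×-congʳ (2 ℕ.+ n) (begin
             V * (F ^ suc n * D F)    ≈⟨ solve 3 (λ V P d → V :* (P :* d) := P :* (V :* d)) refl V (F ^ suc n) (D F) ⟩
             F ^ suc n * (V * D F)    ≈⟨ *-congˡ VDF ⟩
             F ^ suc n * (2 × (F * F)) ≈⟨ ×-comm-* 2 (F ^ suc n) (F * F) ⟩
             2 × (F ^ suc n * (F * F)) ≈⟨ ×-congʳ 2 (solve 2 (λ F P → P :* (F :* F) := F :* (F :* P)) refl F (F ^ suc n)) ⟩
             2 × F ^ (3 ℕ.+ n)         ∎)) ⟩
      q × ((2 ℕ.+ n) × (2 × F ^ (3 ℕ.+ n)))
        ≈⟨ trans (×-congʳ q (×-assocˡ _ (2 ℕ.+ n) 2)) (×-assocˡ _ q _) ⟩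
      (q ℕ.* ((2 ℕ.+ n) ℕ.* 2)) × F ^ (3 ℕ.+ n)
        ≈⟨ ×-congˡ (factor n) ⟩
      (2 ℕ.^ (2 ℕ.+ n) ℕ.* (2 ℕ.+ n) !) × F ^ (3 ℕ.+ n) ∎
      where
      q = 2 ℕ.^ suc n ℕ.* suc n !

-- The Chebyshev generating function in a ring with a derivation.

module ChebyshevDerivation {c ℓ} (S : CommutativeRing c ℓ) (derivation : Derivation S)
  {t : CommutativeRing.Carrier S}
  (D-t : CommutativeRing._≈_ S (Derivation.D derivation t) (CommutativeRing.1# S)) where

  open CommutativeRing S
  open Derivation derivation
  open DiagonalSums S
  open Derivations S derivation
  open Algebra.Properties.Semiring.Mult semiring
  open Algebra.Properties.CommutativeMonoid.Mult +-commutativeMonoid using (×-distrib-+)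
  open Algebra.Properties.CommutativeSemiring.Exp commutativeSemiring
  open Algebra.Properties.Ring ring using (-‿distribˡ-*; -‿distribʳ-*; -‿involutive; -0#≈0#)
  open import Algebra.Solver.Ring.NaturalCoefficients.Default commutativeSemiring
    using (solve; _:+_; _:*_; _:=_; con)
  open Relation.Binary.Reasoning.Setoid setoid

  1-[_]t : Carrier → Carrier
  1-[ e ]t = 1# - e * t

  D-1-[]t : ∀ {e} → D e ≈ 0# → D 1-[ e ]t + e ≈ 0#
  D-1-[]t {e} De≈0 = begin
    D (1# - e * t) + e
      ≈⟨ +-congʳ (trans (D-+ 1# (- (e * t)))
           (trans (+-cong D-1# (D-‿ (e * t))) (+-identityˡ _))) ⟩
    - D (e * t) + e
      ≈⟨ +-congʳ (-‿cong (trans (D-constant-* De≈0 t)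
           (trans (*-congˡ D-t) (*-identityʳ e)))) ⟩
    - e + e
      ≈⟨ -‿inverseˡ e ⟩
    0# ∎

  -- Recurrences between coefficients come in the form `f = g + e t f`; this converts them into a
  -- statement about division by `1 - e t`.
  *-1-[]t : ∀ {e f g} → f ≈ g + e * (t * f) → f * 1-[ e ]t ≈ g
  *-1-[]t {e} {f} {g} f≈ = begin
    f * (1# - e * t)
      ≈⟨ distribˡ f 1# _ ⟩
    f * 1# + f * - (e * t)
      ≈⟨ +-cong (*-identityʳ f) (sym (-‿distribʳ-* f _)) ⟩
    f + - (f * (e * t))
      ≈⟨ +-cong f≈ (-‿cong (solve 3 (λ f e t → f :* (e :* t) := e :* (t :* f)) refl f e t)) ⟩
    g + e * (t * f) + - (e * (t * f))
      ≈⟨ trans (+-assoc _ _ _) (+-congˡ (-‿inverseʳ _)) ⟩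
    g + 0#
      ≈⟨ +-identityʳ g ⟩
    g ∎

  1-[1]t : 1-[ 1# ]t ≈ 1# - t
  1-[1]t = +-congˡ (-‿cong (*-identityˡ t))

  1-[-1]t : 1-[ - 1# ]t ≈ 1# + t
  1-[-1]t = +-congˡ (begin
    - (- 1# * t)  ≈⟨ -‿distribˡ-* _ _ ⟩
    - - 1# * t    ≈⟨ *-congʳ (-‿involutive 1#) ⟩
    1# * t        ≈⟨ *-identityˡ t ⟩
    t             ∎)

  -- The numerator in `1/(1 - t) + 1/(1 + t) = 2/(1 - t²)`, which splits `2F` into two multiples of
  -- `G`.
  1-[1]t+1-[-1]t : 1-[ 1# ]t + 1-[ - 1# ]t ≈ 2 × 1#
  1-[1]t+1-[-1]t = begin
    1-[ 1# ]t + 1-[ - 1# ]t      ≈⟨ +-cong 1-[1]t 1-[-1]t ⟩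
    (1# - t) + (1# + t)          ≈⟨ solve 2 (λ n t → (con 1 :+ n) :+ (con 1 :+ t)
                                      := (con 1 :+ (con 1 :+ con 0)) :+ (n :+ t)) refl (- t) t ⟩
    2 × 1# + (- t + t)           ≈⟨ trans (+-congˡ (-‿inverseˡ t)) (+-identityʳ _) ⟩
    2 × 1#                       ∎

  1-[1]t*1-[-1]t : 1-[ 1# ]t * 1-[ - 1# ]t ≈ 1# - t * t
  1-[1]t*1-[-1]t = begin
    1-[ 1# ]t * 1-[ - 1# ]t          ≈⟨ *-cong 1-[1]t 1-[-1]t ⟩
    (1# - t) * (1# + t)              ≈⟨ solve 2 (λ n t → (con 1 :+ n) :* (con 1 :+ t)
                                          := con 1 :+ n :* t :+ (n :+ t)) refl (- t) t ⟩
    1# + - t * t + (- t + t)         ≈⟨ trans (+-congˡ (-‿inverseˡ t)) (+-identityʳ _) ⟩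
    1# + - t * t                     ≈⟨ +-congˡ (sym (-‿distribˡ-* t t)) ⟩
    1# - t * t                       ∎

  module _ {x y s P A₊ A₋ G : Carrier}
    (Dx≈0 : D x ≈ 0#) (xy≈1 : x * y ≈ 1#) (s≈2x : s ≈ x + x)
    (P-inverse : P * 1-[ y ]t ≈ 1#)
    (A₊-inverse : A₊ * 1-[ 1# ]t ≈ 1#)
    (A₋-inverse : A₋ * 1-[ - 1# ]t ≈ 1#)
    (G-spec : G * (1# - s * t + t * t) ≈ 1# - t * t) where

    private
      w₊ w₋ u V F den : Carrier
      w₊  = 1-[ 1# ]t
      w₋  = 1-[ - 1# ]t
      u   = x - t
      V   = y * P
      F   = (A₊ * A₋) * G
      den = 1-[ s ]t + t * t

      Ds≈0 : D s ≈ 0#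
      Ds≈0 = trans (D-cong s≈2x) (trans (D-+ x x) (trans (+-cong Dx≈0 Dx≈0) (+-identityˡ 0#)))

      D[-1]≈0 : D (- 1#) ≈ 0#
      D[-1]≈0 = trans (D-‿ 1#) (trans (-‿cong D-1#) -0#≈0#)

      A₊+A₋ : A₊ + A₋ ≈ 2 × (A₊ * A₋)
      A₊+A₋ = begin
        A₊ + A₋
          ≈⟨ +-cong (*-identityʳ A₊) (*-identityʳ A₋) ⟨
        A₊ * 1# + A₋ * 1#
          ≈⟨ +-cong (*-congˡ A₋-inverse) (*-congˡ A₊-inverse) ⟨
        A₊ * (A₋ * w₋) + A₋ * (A₊ * w₊)
          ≈⟨ solve 4 (λ A B w v → A :* (B :* v) :+ B :* (A :* w) := (A :* B) :* (w :+ v)) refl A₊ A₋ w₊ w₋ ⟩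
        (A₊ * A₋) * (w₊ + w₋)
          ≈⟨ *-congˡ 1-[1]t+1-[-1]t ⟩
        (A₊ * A₋) * (2 × 1#)
          ≈⟨ trans (×-comm-* 2 (A₊ * A₋) 1#) (×-congʳ 2 (*-identityʳ _)) ⟩
        2 × (A₊ * A₋) ∎

      V-inverse : V * u ≈ 1#
      V-inverse = begin
        y * P * (x - t)
          ≈⟨ solve 4 (λ y P x n → y :* P :* (x :+ n) := P :* (x :* y :+ y :* n)) refl y P x (- t) ⟩
        P * (x * y + y * - t)
          ≈⟨ *-congˡ (+-cong xy≈1 (sym (-‿distribʳ-* y t))) ⟩
        P * (1# - y * t)
          ≈⟨ P-inverse ⟩
        1# ∎

      D-u : D u + 1# ≈ 0#
      D-u = begin
        D (x - t) + 1#      ≈⟨ +-congʳ (trans (D-+ x (- t)) (+-cong Dx≈0 (D-‿ t))) ⟩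
        0# + - D t + 1#     ≈⟨ +-congʳ (trans (+-identityˡ _) (-‿cong D-t)) ⟩
        - 1# + 1#           ≈⟨ -‿inverseˡ 1# ⟩
        0#                  ∎

      D-V : D V ≈ V * V
      D-V = trans (D-inverse V-inverse D-u) (*-identityˡ _)

      -- The factor `A₊ * A₋ = 1/(1 - t²)` cancels the numerator of `G`, which leaves
      -- `F = 1/(1 - 2xt + t²)`.
      F-inverse : F * den ≈ 1#
      F-inverse = begin
        (A₊ * A₋) * G * den              ≈⟨ trans (*-assoc _ G den) (*-congˡ G-spec) ⟩
        (A₊ * A₋) * (1# - t * t)         ≈⟨ *-congˡ 1-[1]t*1-[-1]t ⟨
        (A₊ * A₋) * (w₊ * w₋)            ≈⟨ solve 4 (λ A B w v → (A :* B) :* (w :* v) := (A :* w) :* (B :* v)) refl A₊ A₋ w₊ w₋ ⟩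
        (A₊ * w₊) * (A₋ * w₋)            ≈⟨ *-cong A₊-inverse A₋-inverse ⟩
        1# * 1#                          ≈⟨ *-identityˡ 1# ⟩
        1#                               ∎

      D-den : D den + 2 × u ≈ 0#
      D-den = begin
        D (1-[ s ]t + t * t) + 2 × u
          ≈⟨ +-congʳ (trans (D-+ 1-[ s ]t (t * t)) (+-congˡ (trans (D-* t t) (+-cong (*-congʳ D-t) (*-congˡ D-t))))) ⟩
        D 1-[ s ]t + (1# * t + t * 1#) + 2 × (x - t)
          ≈⟨ solve 4 (λ d t x n → d :+ (con 1 :* t :+ t :* con 1) :+ ((x :+ n) :+ ((x :+ n) :+ con 0))
               := d :+ (x :+ x) :+ ((t :+ n) :+ (t :+ n))) refl (D 1-[ s ]t) t x (- t) ⟩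
        D 1-[ s ]t + (x + x) + ((t - t) + (t - t))
          ≈⟨ +-cong (+-congˡ (sym s≈2x))
               (trans (+-cong (-‿inverseʳ t) (-‿inverseʳ t)) (+-identityˡ 0#)) ⟩
        D 1-[ s ]t + s + 0#
          ≈⟨ trans (+-identityʳ _) (D-1-[]t Ds≈0) ⟩
        0# ∎

      V-*-D-F : V * D F ≈ 2 × (F * F)
      V-*-D-F = begin
        V * D F
          ≈⟨ *-congˡ (D-inverse F-inverse D-den) ⟩
        V * ((2 × u) * (F * F))
          ≈⟨ solve 3 (λ V u F → V :* ((u :+ (u :+ con 0)) :* (F :* F))
               := V :* u :* (F :* F) :+ (V :* u :* (F :* F) :+ con 0)) refl V u F ⟩
        2 × (V * u * (F * F))
          ≈⟨ ×-congʳ 2 (trans (*-congʳ V-inverse) (*-identityˡ _)) ⟩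
        2 × (F * F) ∎

      2×F : 2 × F ≈ A₊ * G + A₋ * G
      2×F = begin
        2 × (A₊ * A₋ * G)      ≈⟨ ×-assoc-* 2 (A₊ * A₋) G ⟨
        (2 × (A₊ * A₋)) * G    ≈⟨ *-congʳ A₊+A₋ ⟨
        (A₊ + A₋) * G          ≈⟨ distribʳ G A₊ A₋ ⟩
        A₊ * G + A₋ * G        ∎

    -- The constant `e ^ k` stands in front, so that on passing to coefficients it becomes the
    -- scalar `(±1)^(i-l)` outside the triple sum.
    summand : (e A : Carrier) (r m l k : ℕ) → Carrier
    summand e A r m l k = weight leibnizRate l k × (e ^ k * (V ^ odeRate r m * (A ^ suc k * fold G D l)))

    odeTerm : (e A : Carrier) → ℕ → ℕ → Carrier
    odeTerm e A r m = weight odeRate r m × diagonal (suc r) (summand e A r m)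

    -- Only `2F`, not `F`, splits into `A₊ * G + A₋ * G`; this costs one further power of 2, whence
    -- `2^(N+1)` for `N = n + 1`.
    chebyshev-^ : ∀ n →
      (2 ℕ.^ (2 ℕ.+ n) ℕ.* suc n !) × (A₊ ^ (2 ℕ.+ n) * (A₋ ^ (2 ℕ.+ n) * G ^ (2 ℕ.+ n))) ≈
      diagonal n (odeTerm 1# A₊) + diagonal n (odeTerm (- 1#) A₋)
    chebyshev-^ n = begin
      (2 ℕ.* q ℕ.* suc n !) × (A₊ ^ (2 ℕ.+ n) * (A₋ ^ (2 ℕ.+ n) * G ^ (2 ℕ.+ n)))
        ≈⟨ ×-congʳ (2 ℕ.* q ℕ.* suc n !) (trans (^-distrib-* (A₊ * A₋) G (2 ℕ.+ n))
             (trans (*-congʳ (^-distrib-* A₊ A₋ (2 ℕ.+ n))) (*-assoc _ _ _))) ⟨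
      (2 ℕ.* q ℕ.* suc n !) × F ^ (2 ℕ.+ n)
        ≈⟨ trans (×-congˡ (ℕₚ.*-assoc 2 q (suc n !))) (sym (×-assocˡ _ 2 (q ℕ.* suc n !))) ⟩
      2 × ((q ℕ.* suc n !) × F ^ (2 ℕ.+ n))
        ≈⟨ ×-congʳ 2 (^-higherDerivatives D-V V-*-D-F n) ⟩
      2 × diagonal n (λ r m → weight odeRate r m × (V ^ odeRate r m * fold F D (suc r)))
        ≈⟨ +-congˡ (+-identityʳ _) ⟩
      diagonal n f + diagonal n f
        ≈⟨ diagonal-+ n f f ⟨
      diagonal n (λ r m → f r m + f r m)
        ≈⟨ diagonal-cong n doubled ⟩
      diagonal n (λ r m → odeTerm 1# A₊ r m + odeTerm (- 1#) A₋ r m)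
        ≈⟨ diagonal-+ n (odeTerm 1# A₊) (odeTerm (- 1#) A₋) ⟩
      diagonal n (odeTerm 1# A₊) + diagonal n (odeTerm (- 1#) A₋) ∎
      where
      q = 2 ℕ.^ suc n

      f : ℕ → ℕ → Carrier
      f r m = weight odeRate r m × (V ^ odeRate r m * fold F D (suc r))

      leibnizTerm : (e A : Carrier) → ℕ → ℕ → Carrier
      leibnizTerm e A l k = weight leibnizRate l k × (e ^ k * (A ^ suc k * fold G D l))

      fold-F : ∀ i → fold F D i + fold F D i ≈
        diagonal i (leibnizTerm 1# A₊) + diagonal i (leibnizTerm (- 1#) A₋)
      fold-F i = begin
        fold F D i + fold F D i
          ≈⟨ fold-+ i F F ⟨
        fold (F + F) D i
          ≈⟨ fold-cong i (trans (+-congˡ (sym (+-identityʳ F))) 2×F) ⟩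
        fold (A₊ * G + A₋ * G) D i
          ≈⟨ fold-+ i (A₊ * G) (A₋ * G) ⟩
        fold (A₊ * G) D i + fold (A₋ * G) D i
          ≈⟨ +-cong (D^-product D-1# (D-inverse A₊-inverse (D-1-[]t D-1#)) G i)
                    (D^-product D[-1]≈0 (D-inverse A₋-inverse (D-1-[]t D[-1]≈0)) G i) ⟩
        diagonal i (leibnizTerm 1# A₊) + diagonal i (leibnizTerm (- 1#) A₋) ∎

      *-leibnizTerm : ∀ e A r m → V ^ odeRate r m * diagonal (suc r) (leibnizTerm e A) ≈
        diagonal (suc r) (summand e A r m)
      *-leibnizTerm e A r m = trans (*-distribˡ-diagonal (suc r) v (leibnizTerm e A))
        (diagonal-cong (suc r) (λ l k →
          trans (×-comm-* (weight leibnizRate l k) v _) (×-congʳ (weight leibnizRate l k)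
            (solve 3 (λ v e z → v :* (e :* z) := e :* (v :* z)) refl v (e ^ k) (A ^ suc k * fold G D l)))))
        where
        v = V ^ odeRate r m

      doubled : ∀ r m → f r m + f r m ≈ odeTerm 1# A₊ r m + odeTerm (- 1#) A₋ r m
      doubled r m = begin
        w × (v * g) + w × (v * g)
          ≈⟨ ×-distrib-+ _ _ w ⟨
        w × (v * g + v * g)
          ≈⟨ ×-congʳ w (begin
               v * g + v * g  ≈⟨ distribˡ v g g ⟨
               v * (g + g)    ≈⟨ *-congˡ (fold-F (suc r)) ⟩
               v * (diagonal (suc r) (leibnizTerm 1# A₊) + diagonal (suc r) (leibnizTerm (- 1#) A₋))
                 ≈⟨ distribˡ v _ _ ⟩
               v * diagonal (suc r) (leibnizTerm 1# A₊) + v * diagonal (suc r) (leibnizTerm (- 1#) A₋)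
                 ≈⟨ +-cong (*-leibnizTerm 1# A₊ r m) (*-leibnizTerm (- 1#) A₋ r m) ⟩
               diagonal (suc r) (summand 1# A₊ r m) + diagonal (suc r) (summand (- 1#) A₋ r m) ∎) ⟩
        w × (diagonal (suc r) (summand 1# A₊ r m) + diagonal (suc r) (summand (- 1#) A₋ r m))
          ≈⟨ ×-distrib-+ _ _ w ⟩
        odeTerm 1# A₊ r m + odeTerm (- 1#) A₋ r m ∎
        where
        w = weight odeRate r m
        v = V ^ odeRate r m
        g = fold F D (suc r)

  inverse-unique : ∀ {A w B B′} → A * w ≈ 1# → B′ * w ≈ B → B′ ≈ A * B
  inverse-unique {A} {w} {B} {B′} Aw≈1 B′w≈B = begin
    B′              ≈⟨ *-identityʳ B′ ⟨
    B′ * 1#         ≈⟨ *-congˡ Aw≈1 ⟨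
    B′ * (A * w)    ≈⟨ solve 3 (λ B A w → B :* (A :* w) := A :* (B :* w)) refl B′ A w ⟩
    A * (B′ * w)    ≈⟨ *-congˡ B′w≈B ⟩
    A * B           ∎

-- Rational constants and closed forms of the Leibniz coefficients.

fromℚᵘ-+ : ∀ p q → ℚ.fromℚᵘ (p ℚᵘ.+ q) ≡ ℚ.fromℚᵘ p ℚ.+ ℚ.fromℚᵘ q
fromℚᵘ-+ p q = ℚₚ.toℚᵘ-injective (ℚᵘₚ.≃-trans (ℚₚ.toℚᵘ-fromℚᵘ (p ℚᵘ.+ q)) (ℚᵘₚ.≃-sym
  (ℚᵘₚ.≃-trans (ℚₚ.toℚᵘ-homo-+ (ℚ.fromℚᵘ p) (ℚ.fromℚᵘ q))
    (ℚᵘₚ.+-cong (ℚₚ.toℚᵘ-fromℚᵘ p) (ℚₚ.toℚᵘ-fromℚᵘ q)))))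

ℕ→ℚ-+ : ∀ m n → ℕ→ℚ (m ℕ.+ n) ≡ ℕ→ℚ m ℚ.+ ℕ→ℚ n
ℕ→ℚ-+ m n = ≡.trans
  (ℚₚ.fromℚᵘ-cong {mkℚᵘ (+ (m ℕ.+ n)) 0} {mkℚᵘ (+ m) 0 ℚᵘ.+ mkℚᵘ (+ n) 0}
    (*≡* (≡.cong (ℤ._* + 1) (≡.cong₂ ℤ._+_ (≡.sym (ℤₚ.*-identityʳ (+ m))) (≡.sym (ℤₚ.*-identityʳ (+ n)))))))
  (fromℚᵘ-+ (mkℚᵘ (+ m) 0) (mkℚᵘ (+ n) 0))

ℕ→ℚ-* : ∀ m n → ℕ→ℚ (m ℕ.* n) ≡ ℕ→ℚ m ℚ.* ℕ→ℚ n
ℕ→ℚ-* zero    n = ≡.sym (ℚₚ.*-zeroˡ (ℕ→ℚ n))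
ℕ→ℚ-* (suc m) n = begin
  ℕ→ℚ (n ℕ.+ m ℕ.* n)              ≡⟨ ℕ→ℚ-+ n (m ℕ.* n) ⟩
  ℕ→ℚ n ℚ.+ ℕ→ℚ (m ℕ.* n)          ≡⟨ ≡.cong (ℕ→ℚ n ℚ.+_) (ℕ→ℚ-* m n) ⟩
  ℕ→ℚ n ℚ.+ ℕ→ℚ m ℚ.* ℕ→ℚ n        ≡⟨ solve 2 (λ m n → n :+ m :* n := (con 1ℚ :+ m) :* n) ≡.refl (ℕ→ℚ m) (ℕ→ℚ n) ⟩
  (1ℚ ℚ.+ ℕ→ℚ m) ℚ.* ℕ→ℚ n         ≡⟨ ≡.cong (ℚ._* ℕ→ℚ n) (ℕ→ℚ-+ 1 m) ⟨
  ℕ→ℚ (suc m) ℚ.* ℕ→ℚ n            ∎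
  where
  open ≡.≡-Reasoning
  open ℚ-Solver.+-*-Solver

half+half : ∀ n → (+ n ℚ./ 2) ℚ.+ (+ n ℚ./ 2) ≡ ℕ→ℚ n
half+half n = ≡.trans (≡.sym (fromℚᵘ-+ (mkℚᵘ (+ n) 1) (mkℚᵘ (+ n) 1)))
  (ℚₚ.fromℚᵘ-cong {mkℚᵘ (+ n) 1 ℚᵘ.+ mkℚᵘ (+ n) 1} {mkℚᵘ (+ n) 0}
    (*≡* (doubling (+ n))))
  where
  -- The 4 is the product of the two denominators 2, which unnormalised addition does not cancel.
  doubling : ∀ n → (n ℤ.* + 2 ℤ.+ n ℤ.* + 2) ℤ.* + 1 ≡ n ℤ.* + 4
  doubling = ℤ-Solver.solve-∀

-- The quotients `(l + k)!/l!` obey the path recurrence because `(k + 1) + (l + 1) = l + k + 2`;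
-- multiplying by `l !` keeps the argument in ℕ.
leibniz-weight : ∀ l k → weight leibnizRate l k ℕ.* l ! ≡ (l ℕ.+ k) !
leibniz-weight zero    zero    = ≡.refl
leibniz-weight zero    (suc k) = begin
  suc k ℕ.* weight leibnizRate 0 k ℕ.* 1    ≡⟨ ℕₚ.*-assoc (suc k) (weight leibnizRate 0 k) 1 ⟩
  suc k ℕ.* (weight leibnizRate 0 k ℕ.* 1)  ≡⟨ ≡.cong (suc k ℕ.*_) (leibniz-weight 0 k) ⟩
  suc k !                                   ∎
  where open ≡.≡-Reasoning
leibniz-weight (suc l) zero    = begin
  w ℕ.* (suc l ℕ.* l !)        ≡⟨ swap w (suc l) (l !) ⟩
  suc l ℕ.* (w ℕ.* l !)        ≡⟨ ≡.cong (suc l ℕ.*_) (leibniz-weight l 0) ⟩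
  suc l ℕ.* (l ℕ.+ 0) !        ≡⟨ ≡.cong (λ n → suc n ℕ.* (l ℕ.+ 0) !) (ℕₚ.+-identityʳ l) ⟨
  (suc l ℕ.+ 0) !              ∎
  where
  open ≡.≡-Reasoning
  w = weight leibnizRate l 0
  swap : ∀ a b c → a ℕ.* (b ℕ.* c) ≡ b ℕ.* (a ℕ.* c)
  swap = ℕ-Solver.solve-∀
leibniz-weight (suc l) (suc k) = begin
  (suc k ℕ.* w₁ ℕ.+ w₂) ℕ.* (suc l ℕ.* l !)
    ≡⟨ expand (suc k) w₁ w₂ (suc l) (l !) ⟩
  suc k ℕ.* (w₁ ℕ.* suc l !) ℕ.+ suc l ℕ.* (w₂ ℕ.* l !)
    ≡⟨ ≡.cong₂ (λ u v → suc k ℕ.* u ℕ.+ suc l ℕ.* v) (leibniz-weight (suc l) k)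
         (≡.trans (leibniz-weight l (suc k)) (≡.cong _! (ℕₚ.+-suc l k))) ⟩
  suc k ℕ.* f ℕ.+ suc l ℕ.* f
    ≡⟨ collect k l f ⟩
  (2 ℕ.+ (l ℕ.+ k)) ℕ.* f
    ≡⟨ ≡.cong (λ n → suc n !) (ℕₚ.+-suc l k) ⟨
  (suc l ℕ.+ suc k) ! ∎
  where
  open ≡.≡-Reasoning
  w₁ = weight leibnizRate (suc l) k
  w₂ = weight leibnizRate l (suc k)
  f = suc (l ℕ.+ k) !
  expand : ∀ a b c d e → (a ℕ.* b ℕ.+ c) ℕ.* (d ℕ.* e) ≡ a ℕ.* (b ℕ.* (d ℕ.* e)) ℕ.+ d ℕ.* (c ℕ.* e)
  expand = ℕ-Solver.solve-∀
  collect : ∀ k l f → suc k ℕ.* f ℕ.+ suc l ℕ.* f ≡ (2 ℕ.+ (l ℕ.+ k)) ℕ.* f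
  collect = ℕ-Solver.solve-∀

/-exact : ∀ w d .{{_ : ℕ.NonZero d}} → + (w ℕ.* d) ℚ./ d ≡ ℕ→ℚ w
/-exact w (suc d) = ℚₚ.fromℚᵘ-cong {mkℚᵘ (+ (w ℕ.* suc d)) d} {mkℚᵘ (+ w) 0}
  (*≡* (≡.trans (ℤₚ.*-identityʳ _) (ℤₚ.pos-* w (suc d))))

!/!-weight : ∀ l k → (l ℕ.+ k) !/ l ! ≡ ℕ→ℚ (weight leibnizRate l k)
!/!-weight l k = ≡.trans
  (≡.cong (λ n → (+ n ℚ./ l !) {{l ℕₚ.!≢0}}) (≡.sym (leibniz-weight l k)))
  (/-exact (weight leibnizRate l k) (l !) {{l ℕₚ.!≢0}})

-- The product `(p + 1)(p + 2)⋯(p + l)`: the factor with which `D^l` carries the coefficient of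
-- `t^(p+l)` to that of `t^p`, and the `(p + l)_l` of the theorem.
risingProduct : ℕ → ℕ → ℕ
risingProduct p zero    = 1
risingProduct p (suc l) = suc (p ℕ.+ l) ℕ.* risingProduct p l

falling-risingProduct : ∀ p l → falling (ℕ→ℚ (p ℕ.+ l)) l ≡ ℕ→ℚ (risingProduct p l)
falling-risingProduct p zero    = ≡.refl
falling-risingProduct p (suc l) = begin
  falling (ℕ→ℚ (p ℕ.+ suc l)) (suc l)
    ≡⟨ ≡.cong (λ n → falling (ℕ→ℚ n) (suc l)) (ℕₚ.+-suc p l) ⟩
  ℕ→ℚ (suc (p ℕ.+ l)) ℚ.* falling (ℕ→ℚ (suc (p ℕ.+ l)) ℚ.- 1ℚ) l
    ≡⟨ ≡.cong (λ y → ℕ→ℚ (suc (p ℕ.+ l)) ℚ.* falling y l) predecessor ⟩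
  ℕ→ℚ (suc (p ℕ.+ l)) ℚ.* falling (ℕ→ℚ (p ℕ.+ l)) l
    ≡⟨ ≡.cong (ℕ→ℚ (suc (p ℕ.+ l)) ℚ.*_) (falling-risingProduct p l) ⟩
  ℕ→ℚ (suc (p ℕ.+ l)) ℚ.* ℕ→ℚ (risingProduct p l)
    ≡⟨ ℕ→ℚ-* (suc (p ℕ.+ l)) (risingProduct p l) ⟨
  ℕ→ℚ (risingProduct p (suc l)) ∎
  where
  open ≡.≡-Reasoning
  open ℚ-Solver.+-*-Solver
  predecessor : ℕ→ℚ (suc (p ℕ.+ l)) ℚ.- 1ℚ ≡ ℕ→ℚ (p ℕ.+ l)
  predecessor = ≡.trans (≡.cong (ℚ._- 1ℚ) (ℕ→ℚ-+ 1 (p ℕ.+ l)))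
    (solve 1 (λ x → con 1ℚ :+ x :- con 1ℚ := x) ≡.refl (ℕ→ℚ (p ℕ.+ l)))

-- The numbers `a` as path counts.

module NestedSums where
  open Sums ℚ-ring using (sumRange; sum-cong-≋)
  open Algebra.Properties.Semiring.Sum (CommutativeRing.semiring ℚ-ring)
    using (*-distribˡ-sum)
  open ≡.≡-Reasoning
  open ℚ-Solver.+-*-Solver

  private
    w = weight odeRate

  -- A path to `(r + 1, M)` is cut at its last horizontal step, which enters column `r + 1` at some
  -- height `M - k`. The `k` vertical steps after it have, from the top down, the rates `2M + r`,
  -- `2M + r - 2`, ..., that is `2y`, `2(y - 1)`, ..., with product `2^k (y)_k`.
  odeWeight-suc : ∀ r M y → y ℚ.+ y ≡ ℕ→ℚ (2 ℕ.* M ℕ.+ r) →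
    ℕ→ℚ (w (suc r) M) ≡ ∑[ 0 ≤ k ≤ M ] ℕ→ℚ (2 ℕ.^ k) ℚ.* falling y k ℚ.* ℕ→ℚ (w r (M ∸ k))
  odeWeight-suc r zero    y 2y≡ = solve 1 (λ x → x := con 1ℚ :* con 1ℚ :* x :+ con 0ℚ) ≡.refl (ℕ→ℚ (w r 0))
  odeWeight-suc r (suc M) y 2y≡ = begin
    ℕ→ℚ (odeRate (suc r) M ℕ.* w (suc r) M ℕ.+ w r (suc M))
      ≡⟨ ≡.cong (λ n → ℕ→ℚ (n ℕ.* w (suc r) M ℕ.+ w r (suc M))) (rate M r) ⟩
    ℕ→ℚ ((2 ℕ.* suc M ℕ.+ r) ℕ.* w (suc r) M ℕ.+ w r (suc M))
      ≡⟨ ≡.trans (ℕ→ℚ-+ ((2 ℕ.* suc M ℕ.+ r) ℕ.* w (suc r) M) (w r (suc M)))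
           (≡.cong (ℚ._+ ℕ→ℚ (w r (suc M))) (ℕ→ℚ-* (2 ℕ.* suc M ℕ.+ r) (w (suc r) M))) ⟩
    ℕ→ℚ (2 ℕ.* suc M ℕ.+ r) ℚ.* ℕ→ℚ (w (suc r) M) ℚ.+ ℕ→ℚ (w r (suc M))
      ≡⟨ ≡.cong₂ (λ u v → u ℚ.* v ℚ.+ ℕ→ℚ (w r (suc M))) (≡.sym 2y≡)
           (odeWeight-suc r M (y ℚ.- 1ℚ) 2[y-1]≡) ⟩
    (y ℚ.+ y) ℚ.* (∑[ 0 ≤ k ≤ M ] term k) ℚ.+ ℕ→ℚ (w r (suc M))
      ≡⟨ ≡.cong (ℚ._+ ℕ→ℚ (w r (suc M))) (*-distribˡ-sum {suc M} (y ℚ.+ y) (λ k → term (toℕ k))) ⟩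
    (∑[ 0 ≤ k ≤ M ] ((y ℚ.+ y) ℚ.* term k)) ℚ.+ ℕ→ℚ (w r (suc M))
      ≡⟨ ≡.cong (ℚ._+ ℕ→ℚ (w r (suc M))) (sum-cong-≋ {suc M} (λ k → shift (toℕ k))) ⟩
    (∑[ 0 ≤ k ≤ M ] term′ (suc k)) ℚ.+ ℕ→ℚ (w r (suc M))
      ≡⟨ solve 2 (λ s x → s :+ x := con 1ℚ :* con 1ℚ :* x :+ s) ≡.refl
           (∑[ 0 ≤ k ≤ M ] term′ (suc k)) (ℕ→ℚ (w r (suc M))) ⟩
    (∑[ 0 ≤ k ≤ suc M ] term′ k) ∎
    where
    term term′ : ℕ → ℚ
    term k  = ℕ→ℚ (2 ℕ.^ k) ℚ.* falling (y ℚ.- 1ℚ) k ℚ.* ℕ→ℚ (w r (M ∸ k))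
    term′ k = ℕ→ℚ (2 ℕ.^ k) ℚ.* falling y k ℚ.* ℕ→ℚ (w r (suc M ∸ k))

    rate : ∀ M r → suc (2 ℕ.* M ℕ.+ suc r) ≡ 2 ℕ.* suc M ℕ.+ r
    rate = ℕ-Solver.solve-∀

    2+ : ∀ M r → 2 ℕ.* suc M ℕ.+ r ≡ 2 ℕ.+ (2 ℕ.* M ℕ.+ r)
    2+ = ℕ-Solver.solve-∀

    2[y-1]≡ : (y ℚ.- 1ℚ) ℚ.+ (y ℚ.- 1ℚ) ≡ ℕ→ℚ (2 ℕ.* M ℕ.+ r)
    2[y-1]≡ = begin
      (y ℚ.- 1ℚ) ℚ.+ (y ℚ.- 1ℚ)
        ≡⟨ solve 1 (λ y → (y :- con 1ℚ) :+ (y :- con 1ℚ) := (y :+ y) :- con (ℕ→ℚ 2)) ≡.refl y ⟩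
      (y ℚ.+ y) ℚ.- ℕ→ℚ 2
        ≡⟨ ≡.cong (ℚ._- ℕ→ℚ 2) (≡.trans 2y≡ (≡.trans (≡.cong ℕ→ℚ (2+ M r)) (ℕ→ℚ-+ 2 (2 ℕ.* M ℕ.+ r)))) ⟩
      ℕ→ℚ 2 ℚ.+ ℕ→ℚ (2 ℕ.* M ℕ.+ r) ℚ.- ℕ→ℚ 2
        ≡⟨ solve 1 (λ x → con (ℕ→ℚ 2) :+ x :- con (ℕ→ℚ 2) := x) ≡.refl (ℕ→ℚ (2 ℕ.* M ℕ.+ r)) ⟩
      ℕ→ℚ (2 ℕ.* M ℕ.+ r) ∎

    shift : ∀ k → (y ℚ.+ y) ℚ.* term k ≡ term′ (suc k)
    shift k = begin
      (y ℚ.+ y) ℚ.* (ℕ→ℚ (2 ℕ.^ k) ℚ.* falling (y ℚ.- 1ℚ) k ℚ.* ℕ→ℚ (w r (M ∸ k)))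
        ≡⟨ solve 4 (λ y p f z → (y :+ y) :* (p :* f :* z) := (con (ℕ→ℚ 2) :* p) :* (y :* f) :* z) ≡.refl
             y (ℕ→ℚ (2 ℕ.^ k)) (falling (y ℚ.- 1ℚ) k) (ℕ→ℚ (w r (M ∸ k))) ⟩
      (ℕ→ℚ 2 ℚ.* ℕ→ℚ (2 ℕ.^ k)) ℚ.* (y ℚ.* falling (y ℚ.- 1ℚ) k) ℚ.* ℕ→ℚ (w r (M ∸ k))
        ≡⟨ ≡.cong (λ u → u ℚ.* (y ℚ.* falling (y ℚ.- 1ℚ) k) ℚ.* ℕ→ℚ (w r (M ∸ k)))
             (ℕ→ℚ-* 2 (2 ℕ.^ k)) ⟨
      term′ (suc k) ∎

  oddDoubleFactorial-weight : ∀ M → oddDoubleFactorial M ≡ w 0 M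
  oddDoubleFactorial-weight zero    = ≡.refl
  oddDoubleFactorial-weight (suc M) =
    ≡.cong₂ ℕ._*_ (rate M) (oddDoubleFactorial-weight M)
    where
    rate : ∀ M → 2 ℕ.* M ℕ.+ 1 ≡ suc (2 ℕ.* M ℕ.+ 0)
    rate = ℕ-Solver.solve-∀

  module _ (i N : ℕ) where

    summand : List ℕ → ℚ
    summand ks = ℕ→ℚ (2 ℕ.^ ListAction.sum ks)
      ℚ.* fallingProduct i N 2 ks
      ℚ.* ℕ→ℚ (oddDoubleFactorial (N ∸ i ∸ ListAction.sum ks))

    -- y is the argument of the falling factorial belonging to the next index.
    double-argument : ∀ r M s (let y = ℕ→ℚ N ℚ.- ℕ→ℚ s ℚ.- (+ (2 ℕ.* i ℕ.+ 2 ∸ (2 ℕ.+ r)) ℚ./ 2)) →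
      r ≤ i → N ≡ i ℕ.+ M ℕ.+ s → y ℚ.+ y ≡ ℕ→ℚ (2 ℕ.* M ℕ.+ r)
    double-argument r M s r≤i N≡ = begin
      (n ℚ.- s′ ℚ.- h) ℚ.+ (n ℚ.- s′ ℚ.- h)
        -- Adding and subtracting `r` pairs it with the truncated difference `d`, for which
        -- `d + r = 2i`.
        ≡⟨ solve 4 (λ n s h r → (n :- s :- h) :+ (n :- s :- h)
             := (n :+ n :+ r) :- (s :+ s) :- (h :+ h :+ r)) ≡.refl n s′ h (ℕ→ℚ r) ⟩
      (n ℚ.+ n ℚ.+ ℕ→ℚ r) ℚ.- (s′ ℚ.+ s′) ℚ.- (h ℚ.+ h ℚ.+ ℕ→ℚ r)
        ≡⟨ ≡.cong₂ (λ u v → (u ℚ.+ u ℚ.+ ℕ→ℚ r) ℚ.- (s′ ℚ.+ s′) ℚ.- v) n≡ 2h+r≡ ⟩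
      ((i′ ℚ.+ M′ ℚ.+ s′) ℚ.+ (i′ ℚ.+ M′ ℚ.+ s′) ℚ.+ ℕ→ℚ r) ℚ.- (s′ ℚ.+ s′) ℚ.- (i′ ℚ.+ i′)
        ≡⟨ solve 4 (λ i M s r → ((i :+ M :+ s) :+ (i :+ M :+ s) :+ r) :- (s :+ s) :- (i :+ i)
             := (M :+ M) :+ r) ≡.refl i′ M′ s′ (ℕ→ℚ r) ⟩
      (M′ ℚ.+ M′) ℚ.+ ℕ→ℚ r
        ≡⟨ ≡.cong (ℚ._+ ℕ→ℚ r) (ℕ→ℚ-+ M M) ⟨
      ℕ→ℚ (M ℕ.+ M) ℚ.+ ℕ→ℚ r
        ≡⟨ ℕ→ℚ-+ (M ℕ.+ M) r ⟨
      ℕ→ℚ (M ℕ.+ M ℕ.+ r)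
        ≡⟨ ≡.cong (λ n → ℕ→ℚ (M ℕ.+ n ℕ.+ r)) (ℕₚ.+-identityʳ M) ⟨
      ℕ→ℚ (2 ℕ.* M ℕ.+ r) ∎
      where
      n = ℕ→ℚ N
      s′ = ℕ→ℚ s
      i′ = ℕ→ℚ i
      M′ = ℕ→ℚ M
      d = 2 ℕ.* i ℕ.+ 2 ∸ (2 ℕ.+ r)
      h = + d ℚ./ 2

      n≡ : n ≡ i′ ℚ.+ M′ ℚ.+ s′
      n≡ = ≡.trans (≡.cong ℕ→ℚ N≡) (≡.trans (ℕ→ℚ-+ (i ℕ.+ M) s) (≡.cong (ℚ._+ s′) (ℕ→ℚ-+ i M)))

      d+r≡ : d ℕ.+ r ≡ i ℕ.+ i
      d+r≡ = begin
        2 ℕ.* i ℕ.+ 2 ∸ (2 ℕ.+ r) ℕ.+ r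
          ≡⟨ ≡.cong (λ u → u ∸ (2 ℕ.+ r) ℕ.+ r) (ℕₚ.+-comm (2 ℕ.* i) 2) ⟩
        2 ℕ.* i ∸ r ℕ.+ r
          ≡⟨ ℕₚ.m∸n+n≡m (ℕₚ.≤-trans r≤i (ℕₚ.m≤m+n i _)) ⟩
        2 ℕ.* i
          ≡⟨ ≡.cong (i ℕ.+_) (ℕₚ.+-identityʳ i) ⟩
        i ℕ.+ i ∎

      2h+r≡ : h ℚ.+ h ℚ.+ ℕ→ℚ r ≡ i′ ℚ.+ i′
      2h+r≡ = ≡.trans (≡.cong (ℚ._+ ℕ→ℚ r) (half+half d))
        (≡.trans (≡.sym (ℕ→ℚ-+ d r)) (≡.trans (≡.cong ℕ→ℚ d+r≡) (ℕ→ℚ-+ i i)))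

    -- Invariant of the nested sum: `ks` holds the numbers of vertical steps in the columns to the
    -- right of `r`, `M` is the height left for columns 0 to `r`, and the `r` sums still to be taken
    -- count the paths to `(r, M)`. After the last one only column 0 remains, with a single path of
    -- weight `(2M - 1)!!`.
    nestedSum-weight : ∀ r M ks → r ≤ i → N ≡ i ℕ.+ M ℕ.+ ListAction.sum ks →
      nestedSum r M summand ks ≡
      ℕ→ℚ (2 ℕ.^ ListAction.sum ks) ℚ.* fallingProduct i N (2 ℕ.+ r) ks ℚ.* ℕ→ℚ (w r M)
    nestedSum-weight zero    M ks r≤i N≡ =
      ≡.cong (λ n → ℕ→ℚ (2 ℕ.^ ListAction.sum ks) ℚ.* fallingProduct i N 2 ks ℚ.* ℕ→ℚ n)
        (≡.trans (≡.cong oddDoubleFactorial rest) (oddDoubleFactorial-weight M))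
      where
      s = ListAction.sum ks
      rest : N ∸ i ∸ s ≡ M
      rest = begin
        N ∸ i ∸ s                    ≡⟨ ≡.cong (λ n → n ∸ i ∸ s) (≡.trans N≡ (ℕₚ.+-assoc i M s)) ⟩
        i ℕ.+ (M ℕ.+ s) ∸ i ∸ s      ≡⟨ ≡.cong (_∸ s) (ℕₚ.m+n∸m≡n i (M ℕ.+ s)) ⟩
        M ℕ.+ s ∸ s                  ≡⟨ ℕₚ.m+n∸n≡m M s ⟩
        M                            ∎
    nestedSum-weight (suc r) M ks r<i N≡ = begin
      (∑[ 0 ≤ k ≤ M ] nestedSum r (M ∸ k) summand (k ∷ ks))
        ≡⟨ sum-cong-≋ {suc M} (λ k → inner (toℕ k) (ℕₚ.≤-pred (toℕ<n k))) ⟩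
      (∑[ 0 ≤ k ≤ M ] (P ℚ.* Q ℚ.* (ℕ→ℚ (2 ℕ.^ k) ℚ.* falling y k ℚ.* ℕ→ℚ (w r (M ∸ k)))))
        ≡⟨ *-distribˡ-sum {suc M} (P ℚ.* Q)
             (λ k → ℕ→ℚ (2 ℕ.^ toℕ k) ℚ.* falling y (toℕ k) ℚ.* ℕ→ℚ (w r (M ∸ toℕ k))) ⟨
      P ℚ.* Q ℚ.* (∑[ 0 ≤ k ≤ M ] ℕ→ℚ (2 ℕ.^ k) ℚ.* falling y k ℚ.* ℕ→ℚ (w r (M ∸ k)))
        ≡⟨ ≡.cong (P ℚ.* Q ℚ.*_) (odeWeight-suc r M y (double-argument r M s r≤i N≡)) ⟨
      P ℚ.* Q ℚ.* ℕ→ℚ (w (suc r) M) ∎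
      where
      r≤i = ℕₚ.<⇒≤ r<i
      s = ListAction.sum ks
      P = ℕ→ℚ (2 ℕ.^ s)
      Q = fallingProduct i N (3 ℕ.+ r) ks
      y = ℕ→ℚ N ℚ.- ℕ→ℚ s ℚ.- (+ (2 ℕ.* i ℕ.+ 2 ∸ (2 ℕ.+ r)) ℚ./ 2)

      inner : ∀ k → k ≤ M → nestedSum r (M ∸ k) summand (k ∷ ks) ≡
        P ℚ.* Q ℚ.* (ℕ→ℚ (2 ℕ.^ k) ℚ.* falling y k ℚ.* ℕ→ℚ (w r (M ∸ k)))
      inner k k≤M = begin
        nestedSum r (M ∸ k) summand (k ∷ ks)
          ≡⟨ nestedSum-weight r (M ∸ k) (k ∷ ks) r≤i N≡′ ⟩
        ℕ→ℚ (2 ℕ.^ (k ℕ.+ s)) ℚ.* (falling y k ℚ.* Q) ℚ.* ℕ→ℚ (w r (M ∸ k))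
          ≡⟨ ≡.cong (λ u → u ℚ.* (falling y k ℚ.* Q) ℚ.* ℕ→ℚ (w r (M ∸ k)))
               (≡.trans (≡.cong ℕ→ℚ (ℕₚ.^-distribˡ-+-* 2 k s)) (ℕ→ℚ-* (2 ℕ.^ k) (2 ℕ.^ s))) ⟩
        ℕ→ℚ (2 ℕ.^ k) ℚ.* P ℚ.* (falling y k ℚ.* Q) ℚ.* ℕ→ℚ (w r (M ∸ k))
          ≡⟨ solve 5 (λ p P f Q z → p :* P :* (f :* Q) :* z := P :* Q :* (p :* f :* z)) ≡.refl
               (ℕ→ℚ (2 ℕ.^ k)) P (falling y k) Q (ℕ→ℚ (w r (M ∸ k))) ⟩
        P ℚ.* Q ℚ.* (ℕ→ℚ (2 ℕ.^ k) ℚ.* falling y k ℚ.* ℕ→ℚ (w r (M ∸ k))) ∎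
        where
        regroup : ∀ i m k s → i ℕ.+ (m ℕ.+ k) ℕ.+ s ≡ i ℕ.+ m ℕ.+ (k ℕ.+ s)
        regroup = ℕ-Solver.solve-∀

        N≡′ : N ≡ i ℕ.+ (M ∸ k) ℕ.+ (k ℕ.+ s)
        N≡′ = ≡.trans N≡ (≡.trans (≡.cong (λ m → i ℕ.+ m ℕ.+ s) (≡.sym (ℕₚ.m∸n+n≡m k≤M)))
          (regroup i (M ∸ k) k s))

  a-weight : ∀ r M → a (suc r) (suc (r ℕ.+ M)) ≡ ℕ→ℚ (w r M)
  a-weight zero    M = ≡.cong ℕ→ℚ (oddDoubleFactorial-weight M)
  a-weight (suc r) M = begin
    nestedSum (suc r) (r ℕ.+ M ∸ r) (summand i N) []
      ≡⟨ ≡.cong (λ m → nestedSum (suc r) m (summand i N) []) (ℕₚ.m+n∸m≡n r M) ⟩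
    nestedSum (suc r) M (summand i N) []
      ≡⟨ nestedSum-weight i N (suc r) M [] (ℕₚ.n≤1+n (suc r)) (≡.sym (ℕₚ.+-identityʳ _)) ⟩
    1ℚ ℚ.* 1ℚ ℚ.* ℕ→ℚ (w (suc r) M)
      ≡⟨ solve 1 (λ x → con 1ℚ :* con 1ℚ :* x := x) ≡.refl (ℕ→ℚ (w (suc r) M)) ⟩
    ℕ→ℚ (w (suc r) M) ∎
    where
    i = 2 ℕ.+ r
    N = 2 ℕ.+ (r ℕ.+ M)

-- A record, so that s and G can be compared without unfolding the equation.
record IsChebyshevGF {c ℓ} (K : CommutativeRing c ℓ)
  (s : CommutativeRing.Carrier K) (G : PowerSeries.Series K) : Set ℓ where
  constructor isChebyshevGF
  open PowerSeries K
  private module S = CommutativeRing seriesRing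
  field
    equation : G *ₛ (S.1# S.- const s *ₛ var +ₛ var *ₛ var) ≈ₛ S.1# S.- var *ₛ var

-- Formal derivatives and binomial series.

module SeriesCalculus {c ℓ} (K : CommutativeRing c ℓ) where
  open CommutativeRing K hiding (zero)
  open Sums K
  open PowerSeries K
  open Algebra.Properties.Semiring.Mult semiring
  open Algebra.Properties.CommutativeMonoid.Mult +-commutativeMonoid using (×-distrib-+)
  open Algebra.Properties.CommutativeSemiring.Exp commutativeSemiring
  open Algebra.Properties.Ring ring using (-0#≈0#)
  open import Algebra.Solver.Ring.NaturalCoefficients.Default commutativeSemiring
    using (solve; _:+_; _:*_; _:=_; con)
  open Relation.Binary.Reasoning.Setoid setoid
  private
    module S = CommutativeRing seriesRing
    module Sₓ = Algebra.Properties.Semiring.Mult S.semiring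
    module S^ = Algebra.Properties.CommutativeSemiring.Exp S.commutativeSemiring
    module ΣS = Sums seriesRing

  D : Series → Series
  D f n = suc n × f (suc n)

  D-cong : ∀ {f g} → f ≈ₛ g → D f ≈ₛ D g
  D-cong f≈g n = ×-congʳ (suc n) (f≈g (suc n))

  D-+ : ∀ f g → D (f +ₛ g) ≈ₛ D f +ₛ D g
  D-+ f g n = ×-distrib-+ (f (suc n)) (g (suc n)) (suc n)

  -- Induction through `f = f₀ + t f⁺`. From `D (t h) = h + t D h` with `h = f⁺ * g` comes one extra
  -- copy of `f⁺ * g`, which supplies the first summand of `D f = f⁺ + t D f⁺`.
  D-* : ∀ f g → D (f *ₛ g) ≈ₛ (D f *ₛ g) +ₛ (f *ₛ D g)
  D-* f g zero    = begin
    1 × (f 0 * g 1 + (f 1 * g 0 + 0#))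
      ≈⟨ solve 4 (λ f₀ f₁ g₀ g₁ → (f₀ :* g₁ :+ (f₁ :* g₀ :+ con 0)) :+ con 0
           := ((f₁ :+ con 0) :* g₀ :+ con 0) :+ (f₀ :* (g₁ :+ con 0) :+ con 0)) refl (f 0) (f 1) (g 0) (g 1) ⟩
    (1 × f 1 * g 0 + 0#) + (f 0 * (1 × g 1) + 0#) ∎
  D-* f g (suc k) = begin
    (2 ℕ.+ k) × (f 0 * g (2 ℕ.+ k) + (f⁺ *ₛ g) (suc k))
      ≈⟨ ×-distrib-+ _ _ (2 ℕ.+ k) ⟩
    (2 ℕ.+ k) × (f 0 * g (2 ℕ.+ k)) + ((f⁺ *ₛ g) (suc k) + D (f⁺ *ₛ g) k)
      ≈⟨ +-cong (sym (×-comm-* (2 ℕ.+ k) (f 0) (g (2 ℕ.+ k)))) (+-congˡ (D-* f⁺ g k)) ⟩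
    f 0 * D g (suc k) + ((f 1 * g (suc k) + ((f⁺ ∘ suc) *ₛ g) k) + ((D f⁺ *ₛ g) k + (f⁺ *ₛ D g) k))
      ≈⟨ solve 6 (λ a f₁ g b c d → a :+ ((f₁ :* g :+ b) :+ (c :+ d))
           := ((f₁ :+ con 0) :* g :+ (b :+ c)) :+ (a :+ d)) refl
           (f 0 * D g (suc k)) (f 1) (g (suc k)) (((f⁺ ∘ suc) *ₛ g) k) ((D f⁺ *ₛ g) k) ((f⁺ *ₛ D g) k) ⟩
    (D f 0 * g (suc k) + (((f⁺ ∘ suc) *ₛ g) k + (D f⁺ *ₛ g) k)) + (f *ₛ D g) (suc k)
      ≈⟨ +-congʳ (+-congˡ (*ₛ-distribʳ g (f⁺ ∘ suc) (D f⁺) k)) ⟨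
    (D f *ₛ g) (suc k) + (f *ₛ D g) (suc k) ∎
    where
    f⁺ : Series
    f⁺ = f ∘ suc

  ×ₛ-coeff : ∀ m f n → (m Sₓ.× f) n ≈ m × f n
  ×ₛ-coeff zero    f n = refl
  ×ₛ-coeff (suc m) f n = +-congˡ (×ₛ-coeff m f n)

  sumₛ-coeff : ∀ k (f : ℕ → Series) n → ΣS.sum {k} (λ i → f (toℕ i)) n ≈ sum {k} (λ i → f (toℕ i) n)
  sumₛ-coeff zero    f n = refl
  sumₛ-coeff (suc k) f n = +-congˡ (sumₛ-coeff k (f ∘ suc) n)

  const-* : ∀ a f → const a *ₛ f ≈ₛ a ·ₛ f
  const-* a f zero    = +-identityʳ _
  const-* a f (suc n) = trans (+-congˡ (*ₛ-zeroˡ 0ₛ f (λ _ → refl) n)) (+-identityʳ _)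

  const-cong : ∀ {a b} → a ≈ b → const a ≈ₛ const b
  const-cong a≈b zero    = a≈b
  const-cong a≈b (suc n) = refl

  const-+ : ∀ a b → const (a + b) ≈ₛ const a +ₛ const b
  const-+ a b zero    = refl
  const-+ a b (suc n) = sym (+-identityʳ 0#)

  const-neg : ∀ a → const (- a) ≈ₛ -ₛ const a
  const-neg a zero    = refl
  const-neg a (suc n) = sym -0#≈0#

  const-*-const : ∀ a b → const a *ₛ const b ≈ₛ const (a * b)
  const-*-const a b zero    = +-identityʳ _
  const-*-const a b (suc n) = trans (const-* a (const b) (suc n)) (zeroʳ a)

  const-^ : ∀ a n → const a S^.^ n ≈ₛ const (a ^ n)
  const-^ a zero    = λ _ → refl
  const-^ a (suc n) = S.trans (S.*-congˡ {const a} (const-^ a n)) (const-*-const a (a ^ n))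

  var-*-zero : ∀ f → (var *ₛ f) 0 ≈ 0#
  var-*-zero f = trans (+-identityʳ _) (zeroˡ _)

  var-*-suc : ∀ f n → (var *ₛ f) (suc n) ≈ f n
  var-*-suc f n = trans (+-cong (zeroˡ _) (*ₛ-identityˡ f n)) (+-identityˡ _)

  ×-zeroʳ : ∀ m → m × 0# ≈ 0#
  ×-zeroʳ zero    = refl
  ×-zeroʳ (suc m) = trans (+-identityˡ _) (×-zeroʳ m)

  D-const : ∀ a → D (const a) ≈ₛ 0ₛ
  D-const a n = ×-zeroʳ (suc n)

  D-var : D var ≈ₛ const 1#
  D-var zero    = +-identityʳ 1#
  D-var (suc n) = ×-zeroʳ (2 ℕ.+ n)

  fold-commute : ∀ l f → fold f D (suc l) ≡ fold (D f) D l
  fold-commute zero    f = ≡.refl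
  fold-commute (suc l) f = ≡.cong D (fold-commute l f)

  D^-coeff : ∀ l f p → fold f D l p ≈ risingProduct p l × f (p ℕ.+ l)
  D^-coeff zero    f p rewrite ℕₚ.+-identityʳ p = sym (×-homo-1 _)
  D^-coeff (suc l) f p rewrite ℕₚ.+-suc p l = begin
    fold f D (suc l) p
      -- Splitting off the innermost derivative keeps `p` fixed and produces the largest factor
      -- `p + l + 1`, the one that `risingProduct` splits off.
      ≡⟨ ≡.cong-app (fold-commute l f) p ⟩
    fold (D f) D l p
      ≈⟨ D^-coeff l (D f) p ⟩
    risingProduct p l × (suc (p ℕ.+ l) × f (suc (p ℕ.+ l)))
      ≈⟨ ×-assocˡ _ (risingProduct p l) (suc (p ℕ.+ l)) ⟩
    (risingProduct p l ℕ.* suc (p ℕ.+ l)) × f (suc (p ℕ.+ l))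
      ≈⟨ ×-congˡ (ℕₚ.*-comm (risingProduct p l) (suc (p ℕ.+ l))) ⟩
    risingProduct p (suc l) × f (suc (p ℕ.+ l)) ∎

  -- The expansion of `1/(1 - a t)^(k+1)`; the exponent exceeds `k` by one.
  binomialSeries : Carrier → ℕ → Series
  binomialSeries a k s = ((k ℕ.+ s) C s) × a ^ s

  -- Pascal's rule, read as `(1 - a t) · (1 - a t)^(-(k+2)) = (1 - a t)^(-(k+1))`.
  binomialSeries-suc : ∀ a k →
    binomialSeries a (suc k) ≈ₛ binomialSeries a k +ₛ (const a *ₛ (var *ₛ binomialSeries a (suc k)))
  binomialSeries-suc a k zero    = begin
    1 × 1#                                      ≈⟨ +-identityʳ _ ⟨
    1 × 1# + 0#                                 ≈⟨ +-congˡ (trans (*-congˡ (var-*-zero f)) (zeroʳ a)) ⟨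
    1 × 1# + a * (var *ₛ f) 0                   ≈⟨ +-congˡ (const-* a (var *ₛ f) 0) ⟨
    1 × 1# + (const a *ₛ (var *ₛ f)) 0          ∎
    where f = binomialSeries a (suc k)
  binomialSeries-suc a k (suc s) = begin
    (suc m C suc s) × a ^ suc s
      ≈⟨ ×-congˡ (nCk+nC[k+1]≡[n+1]C[k+1] m s) ⟨
    ((m C s) ℕ.+ (m C suc s)) × a ^ suc s
      ≈⟨ ×-homo-+ _ (m C s) (m C suc s) ⟩
    (m C s) × (a * a ^ s) + (m C suc s) × a ^ suc s
      ≈⟨ +-comm _ _ ⟩
    (m C suc s) × a ^ suc s + (m C s) × (a * a ^ s)
      ≈⟨ +-congˡ (×-comm-* (m C s) a (a ^ s)) ⟨
    (m C suc s) × a ^ suc s + a * ((m C s) × a ^ s)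
      ≈⟨ +-congˡ (*-congˡ (×-congˡ (≡.cong (_C s) (ℕₚ.+-suc k s)))) ⟩
    (m C suc s) × a ^ suc s + a * f s
      ≈⟨ +-congˡ (trans (const-* a (var *ₛ f) (suc s)) (*-congˡ (var-*-suc f s))) ⟨
    (m C suc s) × a ^ suc s + (const a *ₛ (var *ₛ f)) (suc s) ∎
    where
    m = k ℕ.+ suc s
    f = binomialSeries a (suc k)

  geometric-suc : ∀ a →
    binomialSeries a 0 ≈ₛ const 1# +ₛ (const a *ₛ (var *ₛ binomialSeries a 0))
  geometric-suc a zero    = begin
    1 × 1#                               ≈⟨ ×-homo-1 1# ⟩
    1#                                   ≈⟨ +-identityʳ _ ⟨
    1# + 0#                              ≈⟨ +-congˡ (trans (*-congˡ (var-*-zero f)) (zeroʳ a)) ⟨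
    1# + a * (var *ₛ f) 0                ≈⟨ +-congˡ (const-* a (var *ₛ f) 0) ⟨
    1# + (const a *ₛ (var *ₛ f)) 0       ∎
    where f = binomialSeries a 0
  geometric-suc a (suc s) = begin
    (suc s C suc s) × (a * a ^ s)
      ≈⟨ ×-congˡ (≡.trans (nCn≡1 (suc s)) (≡.sym (nCn≡1 s))) ⟩
    (s C s) × (a * a ^ s)
      ≈⟨ ×-comm-* (s C s) a (a ^ s) ⟨
    a * f s
      ≈⟨ trans (const-* a (var *ₛ f) (suc s)) (*-congˡ (var-*-suc f s)) ⟨
    (const a *ₛ (var *ₛ f)) (suc s)
      ≈⟨ +-identityˡ _ ⟨
    0# + (const a *ₛ (var *ₛ f)) (suc s) ∎
    where f = binomialSeries a 0

  derivation : Derivation seriesRing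
  derivation = record { D = D ; D-cong = D-cong ; D-+ = D-+ ; D-* = D-* }

  open ChebyshevDerivation seriesRing derivation {var} D-var public
    using (1-[_]t; *-1-[]t; inverse-unique; chebyshev-^)

  geometric : Carrier → Series
  geometric a = binomialSeries a 0

  geometric-inverse : ∀ a → geometric a *ₛ 1-[ const a ]t ≈ₛ const 1#
  geometric-inverse a = *-1-[]t {const a} {geometric a} {const 1#} (geometric-suc a)

  geometric-^ : ∀ a k → geometric a S^.^ suc k ≈ₛ binomialSeries a k
  geometric-^ a zero    = S.*-identityʳ (geometric a)
  geometric-^ a (suc k) = S.trans
    (S.*-congˡ {geometric a} (geometric-^ a k))
    (S.sym (inverse-unique {geometric a} {1-[ const a ]t} {binomialSeries a k} {binomialSeries a (suc k)}
      (geometric-inverse a)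
      (*-1-[]t {const a} {binomialSeries a (suc k)} {binomialSeries a k} (binomialSeries-suc a k))))

-- The map `q` is pinned down at natural numbers, since the rational coefficients of the identity
-- all turn out to be natural, and `xᶻ` at negative exponents, since `i - 2N - m < 0` for
-- `1 ≤ i ≤ N`. The fields `s`, `xᶻ` and `τ⟨_⟩` are tied to `x`, `y` and `τ` by equations because in
-- `ℚ⟮x⟯` they are images of polynomials or single fractions, equal to the computed expressions only
-- up to `≈`.
record ChebyshevSetting {c ℓ} (K : CommutativeRing c ℓ) : Set (c ⊔ ℓ) where
  open CommutativeRing K
  open PowerSeries K
  open Algebra.Properties.Semiring.Exp semiring using (_^_)
  open Algebra.Properties.Semiring.Mult semiring using (_×_)
  private
    module S = CommutativeRing seriesRing
    module S^ = Algebra.Properties.Semiring.Exp S.semiring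
  field
    q        : ℚ → Carrier
    q-ℕ      : ∀ n → q (ℕ→ℚ n) ≈ n × 1#
    x y s    : Carrier
    xy≈1     : x * y ≈ 1#
    s≈2x     : s ≈ x + x
    xᶻ       : ℤ → Carrier
    xᶻ-neg   : ∀ n → xᶻ -[1+ n ] ≈ y ^ suc n
    τ        : Series
    τ-spec   : IsChebyshevGF K s τ
    τ⟨_⟩     : ℕ → Series
    τ⟨⟩-spec : ∀ n → τ⟨ n ⟩ ≈ₛ τ S^.^ n

-- The operations are parameters, so that two instances of the identity are compared
-- operation by operation: unfolding the whole statement over ℚ⟮x⟯ is infeasible.
record ChebyshevIdentity {c ℓ} {A : Set c} (_≈_ : A → A → Set ℓ) (_+_ _*_ : A → A → A)
  (-_ : A → A) (1# : A) (_^_ : A → ℕ → A)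
  (∑ : ℕ → ℕ → (ℕ → A) → A) (∑₃ : ℕ → (ℕ → ℕ → ℕ → A) → A)
  (q : ℚ → A) (ν : ℕ → A) (xᶻ : ℤ → A) (τ : ℕ → A) (τ⟨_⟩ : ℕ → ℕ → A) : Set ℓ where
  field
    holds : ∀ n N → 1 ≤ N →
      (ν (2 ℕ.^ (N ℕ.+ 1) ℕ.* N !) *
        ∑₃ n (λ s m p →
          ((ν ((N ℕ.+ s) C s) * ν ((m ℕ.+ N) C m)) * ((- 1#) ^ m)) * τ⟨ N ℕ.+ 1 ⟩ p))
      ≈
      ((∑ 1 N (λ i → ∑ 0 i (λ l →
        (q (a i N) * q (i !/ l !)) *
        ∑₃ n (λ m s p →
          (((ν ((2 ℕ.* N ℕ.+ m ∸ i ∸ 1) C m) * ν ((i ℕ.+ s ∸ l) C s)) *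
            q (falling (ℕ→ℚ (p ℕ.+ l)) l)) *
            xᶻ (+ i ℤ.- + (2 ℕ.* N) ℤ.- + m)) * τ (p ℕ.+ l)))))
      +
      (∑ 1 N (λ i → ∑ 0 i (λ l →
        ((q (a i N) * q (i !/ l !)) * ((- 1#) ^ (i ∸ l))) *
        ∑₃ n (λ m s p →
          ((((((- 1#) ^ s) * ν ((2 ℕ.* N ℕ.+ m ∸ i ∸ 1) C m)) * ν ((i ℕ.+ s ∸ l) C s)) *
            q (falling (ℕ→ℚ (p ℕ.+ l)) l)) *
            xᶻ (+ i ℤ.- + (2 ℕ.* N) ℤ.- + m)) * τ (p ℕ.+ l))))))

-- Comparison of the coefficients of `t^n`.

module CoefficientComparison {c ℓ} (K : CommutativeRing c ℓ) (setting : ChebyshevSetting K) where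
  open CommutativeRing K
  open PowerSeries K
  open SeriesCalculus K
  open ChebyshevSetting setting
  open Algebra.Properties.CommutativeSemiring.Exp commutativeSemiring
  open Algebra.Properties.Semiring.Mult semiring
  open Sums K
  open Algebra.Properties.Semiring.Sum semiring using (*-distribˡ-sum)
  open import Algebra.Solver.Ring.NaturalCoefficients.Default commutativeSemiring
    using (solve; _:*_; _:=_)
  open Relation.Binary.Reasoning.Setoid setoid
  private
    module S = CommutativeRing seriesRing
    module S^ = Algebra.Properties.CommutativeSemiring.Exp S.commutativeSemiring
    module Sₓ = Algebra.Properties.Semiring.Mult S.semiring
    module DS = DiagonalSums seriesRing

  q-* : ∀ n z → n × z ≈ q (ℕ→ℚ n) * z
  q-* n z = sym (trans (*-congʳ (q-ℕ n)) (trans (×-assoc-* n 1# z) (×-congʳ n (*-identityˡ z))))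

  sumTriples-cong : ∀ n {f g : ℕ → ℕ → ℕ → Carrier} → (∀ i j k → f i j k ≈ g i j k) →
    sumTriples n f ≈ sumTriples n g
  sumTriples-cong n f≈g = sum-cong-≋ {suc n} λ i →
    sum-cong-≋ {suc (n ∸ toℕ i)} λ j → f≈g (toℕ i) (toℕ j) (n ∸ toℕ i ∸ toℕ j)

  *ₛ-triple : ∀ f g h n → (f *ₛ (g *ₛ h)) n ≈ (∑[ i + j + k ≡ n ] f i * (g j * h k))
  *ₛ-triple f g h n = sum-cong-≋ {suc n} λ i →
    *-distribˡ-sum {suc (n ∸ toℕ i)} (f (toℕ i)) (λ j → g (toℕ j) * h (n ∸ toℕ i ∸ toℕ j))

  diagonal-coeff : ∀ i (f : ℕ → ℕ → Series) n →
    DS.diagonal i f n ≈ (∑[ 0 ≤ l ≤ i ] f l (i ∸ l) n)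
  diagonal-coeff i f n = sumₛ-coeff (suc i) (λ l → f l (i ∸ l)) n

  V : Series
  V = const y *ₛ geometric y

  -- From `V = y/(1 - y t)`. Taken at `d = 2N - i - 1`, it is the source of the binomial coefficient
  -- with upper entry `2N + m - i - 1` and, as `y = x⁻¹`, of the power `x^(i - 2N - m)`.
  V-^-coeff : ∀ d m → (V S^.^ suc d) m ≈ y ^ suc d * (q (ℕ→ℚ ((d ℕ.+ m) C m)) * y ^ m)
  V-^-coeff d m = begin
    (V S^.^ suc d) m
      ≈⟨ S^.^-distrib-* (const y) (geometric y) (suc d) m ⟩
    ((const y S^.^ suc d) *ₛ (geometric y S^.^ suc d)) m
      ≈⟨ *ₛ-cong {const y S^.^ suc d} {const (y ^ suc d)} {geometric y S^.^ suc d} {binomialSeries y d}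
           (const-^ y (suc d)) (geometric-^ y d) m ⟩
    (const (y ^ suc d) *ₛ binomialSeries y d) m
      ≈⟨ const-* (y ^ suc d) (binomialSeries y d) m ⟩
    y ^ suc d * (((d ℕ.+ m) C m) × y ^ m)
      ≈⟨ *-congˡ (q-* ((d ℕ.+ m) C m) (y ^ m)) ⟩
    y ^ suc d * (q (ℕ→ℚ ((d ℕ.+ m) C m)) * y ^ m) ∎

  term : (N i l m s p : ℕ) → Carrier
  term N i l m s p =
    q (ℕ→ℚ ((2 ℕ.* N ℕ.+ m ∸ i ∸ 1) C m)) * q (ℕ→ℚ ((i ℕ.+ s ∸ l) C s)) *
    q (falling (ℕ→ℚ (p ℕ.+ l)) l) *
    xᶻ (+ i ℤ.- + (2 ℕ.* N) ℤ.- + m) * τ (p ℕ.+ l)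

  -- Both double sums of the theorem in one formula: `a₀ = 1` belongs to `1/(1 - t)` and `a₀ = -1`
  -- to `1/(1 + t)`.
  doubleSum : Carrier → ℕ → ℕ → Carrier
  doubleSum a₀ N n =
    ∑[ 1 ≤ i ≤ N ] ∑[ 0 ≤ l ≤ i ] q (a i N) * q (i !/ l !) * a₀ ^ (i ∸ l) *
      (∑[ m + s + p ≡ n ] a₀ ^ s * term N i l m s p)

  module _ (r M : ℕ) where
    private
      N = suc (r ℕ.+ M)
      d = 2 ℕ.* M ℕ.+ r

      2N : 2 ℕ.* N ≡ suc r ℕ.+ suc d
      2N = expand r M
        where
        expand : ∀ r M → 2 ℕ.* suc (r ℕ.+ M) ≡ suc r ℕ.+ suc (2 ℕ.* M ℕ.+ r)
        expand = ℕ-Solver.solve-∀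

    exponent : ∀ m → + suc r ℤ.- + (2 ℕ.* N) ℤ.- + m ≡ -[1+ d ℕ.+ m ]
    exponent m = ≡.trans (≡.cong (λ n → + suc r ℤ.- + n ℤ.- + m) 2N) (cancel (+ suc r) (+ suc d) (+ m))
      where
      cancel : ∀ i o m → i ℤ.- (i ℤ.+ o) ℤ.- m ≡ ℤ.- (o ℤ.+ m)
      cancel = ℤ-Solver.solve-∀

    upper : ∀ m → 2 ℕ.* N ℕ.+ m ∸ suc r ∸ 1 ≡ d ℕ.+ m
    upper m = ≡.trans (≡.cong (λ n → n ℕ.+ m ∸ suc r ∸ 1) 2N)
      (≡.cong (_∸ 1) (≡.trans (≡.cong (_∸ suc r) (ℕₚ.+-assoc (suc r) (suc d) m)) (ℕₚ.m+n∸m≡n (suc r) _)))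

    -- Each factor supplies one summation index: `V^(2N-i)` gives `m`, `1/(1 - a₀ t)^(i-l+1)` gives
    -- `s`, and `D^l τ` gives `p`.
    product-coeff : ∀ a₀ l k → l ℕ.+ k ≡ suc r → ∀ n →
      ((V S^.^ odeRate r M) *ₛ ((geometric a₀ S^.^ suc k) *ₛ fold τ D l)) n ≈
      (∑[ m + s + p ≡ n ] a₀ ^ s * term N (suc r) l m s p)
    product-coeff a₀ l k l+k≡ n = trans
      (*ₛ-triple (V S^.^ odeRate r M) (geometric a₀ S^.^ suc k) (fold τ D l) n)
      (sumTriples-cong n coeff)
      where
      i+s∸l : ∀ s → suc r ℕ.+ s ∸ l ≡ k ℕ.+ s
      i+s∸l s = ≡.trans (≡.cong (λ i → i ℕ.+ s ∸ l) (≡.sym l+k≡))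
        (≡.trans (≡.cong (_∸ l) (ℕₚ.+-assoc l k s)) (ℕₚ.m+n∸m≡n l (k ℕ.+ s)))

      coeff : ∀ m s p →
        (V S^.^ odeRate r M) m * ((geometric a₀ S^.^ suc k) s * fold τ D l p) ≈
        a₀ ^ s * term N (suc r) l m s p
      coeff m s p = begin
        (V S^.^ odeRate r M) m * ((geometric a₀ S^.^ suc k) s * fold τ D l p)
          ≈⟨ *-cong (V-^-coeff d m) (*-cong
               (trans (geometric-^ a₀ k s) (q-* ((k ℕ.+ s) C s) (a₀ ^ s)))
               (trans (D^-coeff l τ p) (q-* (risingProduct p l) (τ (p ℕ.+ l))))) ⟩
        (y ^ suc d * (b₁ * y ^ m)) * ((b₂ * a₀ ^ s) * (b₃ * τ (p ℕ.+ l)))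
          ≈⟨ solve 7 (λ Y b Z e A f t → (Y :* (b :* Z)) :* ((e :* A) :* (f :* t))
               := A :* (b :* e :* f :* (Y :* Z) :* t)) refl
               (y ^ suc d) b₁ (y ^ m) b₂ (a₀ ^ s) b₃ (τ (p ℕ.+ l)) ⟩
        a₀ ^ s * (b₁ * b₂ * b₃ * (y ^ suc d * y ^ m) * τ (p ℕ.+ l))
          ≈⟨ *-congˡ (*-congʳ (*-cong (*-cong (*-cong
               (reflexive (≡.cong (λ u → q (ℕ→ℚ (u C m))) (≡.sym (upper m))))
               (reflexive (≡.cong (λ u → q (ℕ→ℚ (u C s))) (≡.sym (i+s∸l s)))))
               (reflexive (≡.cong q (≡.sym (falling-risingProduct p l)))))
               power)) ⟩
        a₀ ^ s * term N (suc r) l m s p ∎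
        where
        b₁ = q (ℕ→ℚ ((d ℕ.+ m) C m))
        b₂ = q (ℕ→ℚ ((k ℕ.+ s) C s))
        b₃ = q (ℕ→ℚ (risingProduct p l))

        power : y ^ suc d * y ^ m ≈ xᶻ (+ suc r ℤ.- + (2 ℕ.* N) ℤ.- + m)
        power = begin
          y ^ suc d * y ^ m                              ≈⟨ ^-homo-* y (suc d) m ⟨
          y ^ suc (d ℕ.+ m)                              ≈⟨ xᶻ-neg (d ℕ.+ m) ⟨
          xᶻ -[1+ d ℕ.+ m ]                              ≡⟨ ≡.cong xᶻ (exponent m) ⟨
          xᶻ (+ suc r ℤ.- + (2 ℕ.* N) ℤ.- + m)           ∎

  module _ (e : Series) (a₀ : Carrier) (e≈a₀ : e ≈ₛ const a₀) where

    private
      inner : (r m l k : ℕ) → Series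
      inner r m l k = (V S^.^ odeRate r m) *ₛ ((geometric a₀ S^.^ suc k) *ₛ fold τ D l)

      scaled : (r m l k : ℕ) → Series
      scaled r m l k = weight leibnizRate l k Sₓ.× ((e S^.^ k) *ₛ inner r m l k)

    -- Agrees by unfolding with the summands of `chebyshev-^`. The series `e` is kept apart from
    -- `const a₀` because there `-1` is the negated unit series, which equals `const (- 1#)` only
    -- coefficientwise.
    odeSeries : ℕ → ℕ → Series
    odeSeries r m = weight odeRate r m Sₓ.× DS.diagonal (suc r) (scaled r m)

    e^*-coeff : ∀ k f n → ((e S^.^ k) *ₛ f) n ≈ a₀ ^ k * f n
    e^*-coeff k f n = begin
      ((e S^.^ k) *ₛ f) n
        ≈⟨ *ₛ-cong {e S^.^ k} {const (a₀ ^ k)} {f} {f}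
             (S.trans (S^.^-congˡ k e≈a₀) (const-^ a₀ k)) (λ _ → refl) n ⟩
      (const (a₀ ^ k) *ₛ f) n
        ≈⟨ const-* (a₀ ^ k) f n ⟩
      a₀ ^ k * f n ∎

    scaled-coeff : ∀ r M l k → l ℕ.+ k ≡ suc r → ∀ n → scaled r M l k n ≈
      q (suc r !/ l !) * (a₀ ^ k * (∑[ m + s + p ≡ n ] a₀ ^ s * term (suc (r ℕ.+ M)) (suc r) l m s p))
    scaled-coeff r M l k l+k≡ n = begin
      scaled r M l k n
        ≈⟨ ×ₛ-coeff (weight leibnizRate l k) ((e S^.^ k) *ₛ inner r M l k) n ⟩
      weight leibnizRate l k × ((e S^.^ k) *ₛ inner r M l k) n
        ≈⟨ ×-congʳ (weight leibnizRate l k) (trans (e^*-coeff k (inner r M l k) n)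
             (*-congˡ (product-coeff r M a₀ l k l+k≡ n))) ⟩
      weight leibnizRate l k × (a₀ ^ k * σ)
        ≈⟨ q-* (weight leibnizRate l k) (a₀ ^ k * σ) ⟩
      q (ℕ→ℚ (weight leibnizRate l k)) * (a₀ ^ k * σ)
        ≈⟨ *-congʳ (reflexive (≡.cong q (≡.trans (≡.sym (!/!-weight l k)) (≡.cong (_!/ l !) l+k≡)))) ⟩
      q (suc r !/ l !) * (a₀ ^ k * σ) ∎
      where
      σ = ∑[ m + s + p ≡ n ] a₀ ^ s * term (suc (r ℕ.+ M)) (suc r) l m s p

    odeSeries-coeff : ∀ r M n → odeSeries r M n ≈
      (∑[ 0 ≤ l ≤ suc r ] q (a (suc r) (suc (r ℕ.+ M))) * q (suc r !/ l !) * a₀ ^ (suc r ∸ l) *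
        (∑[ m + s + p ≡ n ] a₀ ^ s * term (suc (r ℕ.+ M)) (suc r) l m s p))
    odeSeries-coeff r M n = begin
      odeSeries r M n
        ≈⟨ ×ₛ-coeff (weight odeRate r M) (DS.diagonal (suc r) (scaled r M)) n ⟩
      weight odeRate r M × DS.diagonal (suc r) (scaled r M) n
        ≈⟨ ×-congʳ (weight odeRate r M) (trans (diagonal-coeff (suc r) (scaled r M) n)
             (sum-cong-≋ {2 ℕ.+ r} (λ l → scaled-coeff r M (toℕ l) (suc r ∸ toℕ l)
               (ℕₚ.m+[n∸m]≡n (ℕₚ.≤-pred (toℕ<n l))) n))) ⟩
      weight odeRate r M × (∑[ 0 ≤ l ≤ suc r ] g l)
        ≈⟨ q-* (weight odeRate r M) (∑[ 0 ≤ l ≤ suc r ] g l) ⟩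
      q (ℕ→ℚ (weight odeRate r M)) * (∑[ 0 ≤ l ≤ suc r ] g l)
        ≈⟨ *-congʳ (reflexive (≡.cong q (≡.sym (NestedSums.a-weight r M)))) ⟩
      q (a (suc r) N) * (∑[ 0 ≤ l ≤ suc r ] g l)
        ≈⟨ *-distribˡ-sum {2 ℕ.+ r} (q (a (suc r) N)) (λ l → g (toℕ l)) ⟩
      (∑[ 0 ≤ l ≤ suc r ] q (a (suc r) N) * g l)
        ≈⟨ sum-cong-≋ {2 ℕ.+ r} (λ l → solve 4 (λ A e u σ → A :* (e :* (u :* σ)) := A :* e :* u :* σ) refl
             (q (a (suc r) N)) (q (suc r !/ toℕ l !)) (a₀ ^ (suc r ∸ toℕ l)) (σ (toℕ l))) ⟩
      (∑[ 0 ≤ l ≤ suc r ] q (a (suc r) N) * q (suc r !/ l !) * a₀ ^ (suc r ∸ l) * σ l) ∎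
      where
      N = suc (r ℕ.+ M)

      σ g : ℕ → Carrier
      σ l = ∑[ m + s + p ≡ n ] a₀ ^ s * term N (suc r) l m s p
      g l = q (suc r !/ l !) * (a₀ ^ (suc r ∸ l) * σ l)

    diagonal-odeSeries-coeff : ∀ n′ n → DS.diagonal n′ odeSeries n ≈ doubleSum a₀ (suc n′) n
    diagonal-odeSeries-coeff n′ n = trans (diagonal-coeff n′ odeSeries n)
      -- The sum over `i` from 1 is the sum over `r` from 0 with `i = suc r`; each summand has `N`
      -- in the form `suc (r + (n′ - r))`, which is brought to the common value `suc n′`.
      (sum-cong-≋ {suc n′} λ r → trans (odeSeries-coeff (toℕ r) (n′ ∸ toℕ r) n)
        (reflexive (≡.cong (row (toℕ r)) (≡.cong suc (ℕₚ.m+[n∸m]≡n (ℕₚ.≤-pred (toℕ<n r)))))))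
      where
      row : ℕ → ℕ → Carrier
      row r N = ∑[ 0 ≤ l ≤ suc r ] q (a (suc r) N) * q (suc r !/ l !) * a₀ ^ (suc r ∸ l) *
        (∑[ m + s + p ≡ n ] a₀ ^ s * term N (suc r) l m s p)

  series-identity : ∀ n′ →
    (2 ℕ.^ (2 ℕ.+ n′) ℕ.* suc n′ !) Sₓ.×
      ((geometric 1# S^.^ (2 ℕ.+ n′)) *ₛ ((geometric (- 1#) S^.^ (2 ℕ.+ n′)) *ₛ (τ S^.^ (2 ℕ.+ n′)))) ≈ₛ
    DS.diagonal n′ (odeSeries S.1# 1# (λ _ → refl)) +ₛ
    DS.diagonal n′ (odeSeries (S.- S.1#) (- 1#) (S.sym (const-neg 1#)))
  series-identity = chebyshev-^ {const x} {const y} {const s} {geometric y}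
    {geometric 1#} {geometric (- 1#)} {τ}
    (D-const x)
    (S.trans (const-*-const x y) (const-cong xy≈1))
    (S.trans (const-cong s≈2x) (const-+ x x))
    (geometric-inverse y)
    (geometric-inverse 1#)
    (S.trans (S.*-congˡ {geometric (- 1#)} (S.+-congˡ {S.1#}
        (S.-‿cong (S.*-congʳ {var} {S.- S.1#} {const (- 1#)} (S.sym (const-neg 1#))))))
      (geometric-inverse (- 1#)))
    (IsChebyshevGF.equation τ-spec)

  leftHandSide-coeff : ∀ N n →
    ((geometric 1# S^.^ suc N) *ₛ ((geometric (- 1#) S^.^ suc N) *ₛ (τ S^.^ suc N))) n ≈
    (∑[ s + m + p ≡ n ]
      q (ℕ→ℚ ((N ℕ.+ s) C s)) * q (ℕ→ℚ ((m ℕ.+ N) C m)) * (- 1#) ^ m * τ⟨ N ℕ.+ 1 ⟩ p)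
  leftHandSide-coeff N n = trans
    (*ₛ-triple (geometric 1# S^.^ suc N) (geometric (- 1#) S^.^ suc N) (τ S^.^ suc N) n)
    (sumTriples-cong n coeff)
    where
    1^ : ∀ n → 1# ^ n ≈ 1#
    1^ zero    = refl
    1^ (suc n) = trans (*-identityˡ _) (1^ n)

    coeff : ∀ s m p →
      (geometric 1# S^.^ suc N) s * ((geometric (- 1#) S^.^ suc N) m * (τ S^.^ suc N) p) ≈
      q (ℕ→ℚ ((N ℕ.+ s) C s)) * q (ℕ→ℚ ((m ℕ.+ N) C m)) * (- 1#) ^ m * τ⟨ N ℕ.+ 1 ⟩ p
    coeff s m p = begin
      (geometric 1# S^.^ suc N) s * ((geometric (- 1#) S^.^ suc N) m * (τ S^.^ suc N) p)
        ≈⟨ *-cong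
             (trans (geometric-^ 1# N s) (trans (q-* ((N ℕ.+ s) C s) (1# ^ s)) (trans (*-congˡ (1^ s)) (*-identityʳ _))))
             (*-cong
               (trans (geometric-^ (- 1#) N m) (trans (q-* ((N ℕ.+ m) C m) ((- 1#) ^ m))
                 (*-congʳ (reflexive (≡.cong (λ u → q (ℕ→ℚ (u C m))) (ℕₚ.+-comm N m))))))
               (trans (reflexive (≡.cong (λ u → (τ S^.^ u) p) (ℕₚ.+-comm 1 N))) (sym (τ⟨⟩-spec (N ℕ.+ 1) p)))) ⟩
      q (ℕ→ℚ ((N ℕ.+ s) C s)) * (q (ℕ→ℚ ((m ℕ.+ N) C m)) * (- 1#) ^ m * τ⟨ N ℕ.+ 1 ⟩ p)
        ≈⟨ solve 4 (λ a b c d → a :* (b :* c :* d) := a :* b :* c :* d) refl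
             (q (ℕ→ℚ ((N ℕ.+ s) C s))) (q (ℕ→ℚ ((m ℕ.+ N) C m))) ((- 1#) ^ m) (τ⟨ N ℕ.+ 1 ⟩ p) ⟩
      q (ℕ→ℚ ((N ℕ.+ s) C s)) * q (ℕ→ℚ ((m ℕ.+ N) C m)) * (- 1#) ^ m * τ⟨ N ℕ.+ 1 ⟩ p ∎

  doubleSum-1 : ∀ N n → doubleSum 1# N n ≈
    (∑[ 1 ≤ i ≤ N ] ∑[ 0 ≤ l ≤ i ] q (a i N) * q (i !/ l !) * (∑[ m + s + p ≡ n ] term N i l m s p))
  doubleSum-1 N n = sum-cong-≋ {N} λ i₀ → sum-cong-≋ {2 ℕ.+ toℕ i₀} λ l₀ →
    row (suc (toℕ i₀)) (toℕ l₀)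
    where
    1^* : ∀ k z → 1# ^ k * z ≈ z
    1^* zero    z = *-identityˡ z
    1^* (suc k) z = trans (*-congʳ (*-identityˡ _)) (1^* k z)

    row : ∀ i l → q (a i N) * q (i !/ l !) * 1# ^ (i ∸ l) *
      (∑[ m + s + p ≡ n ] 1# ^ s * term N i l m s p) ≈
      q (a i N) * q (i !/ l !) * (∑[ m + s + p ≡ n ] term N i l m s p)
    row i l = trans (*-assoc _ _ _) (*-congˡ (trans (1^* (i ∸ l) _)
      (sumTriples-cong n (λ m s p → 1^* s (term N i l m s p)))))

  doubleSum-[-1] : ∀ N n → doubleSum (- 1#) N n ≈
    (∑[ 1 ≤ i ≤ N ] ∑[ 0 ≤ l ≤ i ] q (a i N) * q (i !/ l !) * (- 1#) ^ (i ∸ l) *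
      (∑[ m + s + p ≡ n ]
        (- 1#) ^ s * q (ℕ→ℚ ((2 ℕ.* N ℕ.+ m ∸ i ∸ 1) C m)) * q (ℕ→ℚ ((i ℕ.+ s ∸ l) C s)) *
        q (falling (ℕ→ℚ (p ℕ.+ l)) l) *
        xᶻ (+ i ℤ.- + (2 ℕ.* N) ℤ.- + m) * τ (p ℕ.+ l)))
  doubleSum-[-1] N n = sum-cong-≋ {N} λ i₀ → sum-cong-≋ {2 ℕ.+ toℕ i₀} λ l₀ →
    row (suc (toℕ i₀)) (toℕ l₀)
    where
    reassociate : ∀ i l m s p → (- 1#) ^ s * term N i l m s p ≈
      (- 1#) ^ s * q (ℕ→ℚ ((2 ℕ.* N ℕ.+ m ∸ i ∸ 1) C m)) * q (ℕ→ℚ ((i ℕ.+ s ∸ l) C s)) *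
      q (falling (ℕ→ℚ (p ℕ.+ l)) l) *
      xᶻ (+ i ℤ.- + (2 ℕ.* N) ℤ.- + m) * τ (p ℕ.+ l)
    reassociate i l m s p =
      solve 6 (λ e b c f X t → e :* (b :* c :* f :* X :* t) := e :* b :* c :* f :* X :* t) refl
        ((- 1#) ^ s) (q (ℕ→ℚ ((2 ℕ.* N ℕ.+ m ∸ i ∸ 1) C m))) (q (ℕ→ℚ ((i ℕ.+ s ∸ l) C s)))
        (q (falling (ℕ→ℚ (p ℕ.+ l)) l)) (xᶻ (+ i ℤ.- + (2 ℕ.* N) ℤ.- + m)) (τ (p ℕ.+ l))

    row : ∀ i l → q (a i N) * q (i !/ l !) * (- 1#) ^ (i ∸ l) *
      (∑[ m + s + p ≡ n ] (- 1#) ^ s * term N i l m s p) ≈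
      q (a i N) * q (i !/ l !) * (- 1#) ^ (i ∸ l) *
      (∑[ m + s + p ≡ n ]
        (- 1#) ^ s * q (ℕ→ℚ ((2 ℕ.* N ℕ.+ m ∸ i ∸ 1) C m)) * q (ℕ→ℚ ((i ℕ.+ s ∸ l) C s)) *
        q (falling (ℕ→ℚ (p ℕ.+ l)) l) *
        xᶻ (+ i ℤ.- + (2 ℕ.* N) ℤ.- + m) * τ (p ℕ.+ l))
    row i l = *-congˡ (sumTriples-cong n (reassociate i l))

  identity : ChebyshevIdentity _≈_ _+_ _*_ -_ 1# _^_ sumRange sumTriples
    q (λ n → q (ℕ→ℚ n)) xᶻ τ τ⟨_⟩
  -- The case `N = 0` contradicts `1 ≤ N`; `n′ = N - 1` is the length of the lattice paths.
  ChebyshevIdentity.holds identity n (suc n′) _ = begin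
    q (ℕ→ℚ (2 ℕ.^ (suc n′ ℕ.+ 1) ℕ.* suc n′ !)) * _
      ≈⟨ *-congˡ (leftHandSide-coeff (suc n′) n) ⟨
    q (ℕ→ℚ (2 ℕ.^ (suc n′ ℕ.+ 1) ℕ.* suc n′ !)) * f n
      ≈⟨ *-congʳ (reflexive (≡.cong (λ u → q (ℕ→ℚ (2 ℕ.^ u ℕ.* suc n′ !))) (ℕₚ.+-comm (suc n′) 1))) ⟩
    q (ℕ→ℚ c₀) * f n
      ≈⟨ q-* c₀ (f n) ⟨
    c₀ × f n
      ≈⟨ ×ₛ-coeff c₀ f n ⟨
    (c₀ Sₓ.× f) n
      ≈⟨ series-identity n′ n ⟩
    DS.diagonal n′ (odeSeries S.1# 1# (λ _ → refl)) n +
    DS.diagonal n′ (odeSeries (S.- S.1#) (- 1#) (S.sym (const-neg 1#))) n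
      ≈⟨ +-cong
           (trans (diagonal-odeSeries-coeff S.1# 1# (λ _ → refl) n′ n) (doubleSum-1 (suc n′) n))
           (trans (diagonal-odeSeries-coeff (S.- S.1#) (- 1#) (S.sym (const-neg 1#)) n′ n)
             (doubleSum-[-1] (suc n′) n)) ⟩
    _ ∎
    where
    c₀ = 2 ℕ.^ (2 ℕ.+ n′) ℕ.* suc n′ !

    f : Series
    f = (geometric 1# S^.^ (2 ℕ.+ n′)) *ₛ ((geometric (- 1#) S^.^ (2 ℕ.+ n′)) *ₛ (τ S^.^ (2 ℕ.+ n′)))

-- Power series under a ring homomorphism of the coefficients.

module SeriesHomomorphism {c ℓ c′ ℓ′} (R : CommutativeRing c ℓ) (K : CommutativeRing c′ ℓ′)
  {φ : CommutativeRing.Carrier R → CommutativeRing.Carrier K}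
  (isHomomorphism : IsRingHomomorphism (CommutativeRing.rawRing R) (CommutativeRing.rawRing K) φ) where

  open CommutativeRing K
  open IsRingHomomorphism isHomomorphism
    renaming (⟦⟧-cong to φ-cong; +-homo to φ-+; *-homo to φ-*; -‿homo to φ-‿; 0#-homo to φ-0#; 1#-homo to φ-1#)
  open Relation.Binary.Reasoning.Setoid setoid
  private
    module R = CommutativeRing R
    module RS = PowerSeries R
    module KS = PowerSeries K
    module R⟦t⟧ = CommutativeRing RS.seriesRing
    module K⟦t⟧ = CommutativeRing KS.seriesRing
    module R^ = Algebra.Properties.CommutativeSemiring.Exp R⟦t⟧.commutativeSemiring
    module K^ = Algebra.Properties.CommutativeSemiring.Exp K⟦t⟧.commutativeSemiring
  open KS using (_≈ₛ_)

  map-* : ∀ f g → φ ∘ (f RS.*ₛ g) ≈ₛ (φ ∘ f) KS.*ₛ (φ ∘ g)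
  map-* f g zero    = begin
    φ (f 0 R.* g 0 R.+ R.0#)    ≈⟨ φ-+ _ _ ⟩
    φ (f 0 R.* g 0) + φ R.0#    ≈⟨ +-cong (φ-* _ _) φ-0# ⟩
    φ (f 0) * φ (g 0) + 0#      ∎
  map-* f g (suc n) = begin
    φ (f 0 R.* g (suc n) R.+ ((f ∘ suc) RS.*ₛ g) n)      ≈⟨ φ-+ _ _ ⟩
    φ (f 0 R.* g (suc n)) + φ (((f ∘ suc) RS.*ₛ g) n)    ≈⟨ +-cong (φ-* _ _) (map-* (f ∘ suc) g n) ⟩
    ((φ ∘ f) KS.*ₛ (φ ∘ g)) (suc n)                      ∎

  map-const : ∀ a → φ ∘ RS.const a ≈ₛ KS.const (φ a)
  map-const a zero    = refl
  map-const a (suc n) = φ-0#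

  map-1# : φ ∘ R⟦t⟧.1# ≈ₛ K⟦t⟧.1#
  map-1# zero    = φ-1#
  map-1# (suc n) = φ-0#

  map-var : φ ∘ RS.var ≈ₛ KS.var
  map-var zero    = φ-0#
  map-var (suc n) = map-1# n

  map-var*var : φ ∘ (RS.var RS.*ₛ RS.var) ≈ₛ KS.var KS.*ₛ KS.var
  map-var*var = K⟦t⟧.trans (map-* RS.var RS.var)
    (KS.*ₛ-cong {φ ∘ RS.var} {KS.var} {φ ∘ RS.var} {KS.var} map-var map-var)

  map-^ : ∀ f n → φ ∘ (f R^.^ n) ≈ₛ (φ ∘ f) K^.^ n
  map-^ f zero    = map-1#
  map-^ f (suc n) = K⟦t⟧.trans (map-* f (f R^.^ n))
    (KS.*ₛ-cong {φ ∘ f} {φ ∘ f} {φ ∘ (f R^.^ n)} {(φ ∘ f) K^.^ n} (λ _ → refl) (map-^ f n))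

  private
    map-1-_ : ∀ {f g} → φ ∘ f ≈ₛ g → φ ∘ (R⟦t⟧.1# R⟦t⟧.- f) ≈ₛ K⟦t⟧.1# K⟦t⟧.- g
    map-1-_ f≈g n = trans (φ-+ _ _) (+-cong (map-1# n) (trans (φ-‿ _) (-‿cong (f≈g n))))

  -- What is transported is the equation of the generating function and not its construction by long
  -- division: the equation only involves ring operations, which the coefficientwise map preserves.
  map-chebyshevGF : ∀ {s G} → IsChebyshevGF R s G → IsChebyshevGF K (φ s) (φ ∘ G)
  map-chebyshevGF {s} {G} (isChebyshevGF spec) = isChebyshevGF λ n → begin
    ((φ ∘ G) KS.*ₛ denK) n    ≈⟨ KS.*ₛ-cong {φ ∘ G} {φ ∘ G} {φ ∘ denR} {denK} (λ _ → refl) map-den n ⟨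
    ((φ ∘ G) KS.*ₛ (φ ∘ denR)) n      ≈⟨ map-* G denR n ⟨
    φ ((G RS.*ₛ denR) n)              ≈⟨ φ-cong (spec n) ⟩
    φ (numR n)                        ≈⟨ map-1-_ {RS.var RS.*ₛ RS.var} {KS.var KS.*ₛ KS.var} map-var*var n ⟩
    numK n                            ∎
    where
    denR numR : RS.Series
    denR = R⟦t⟧.1# R⟦t⟧.- RS.const s RS.*ₛ RS.var RS.+ₛ RS.var RS.*ₛ RS.var
    numR = R⟦t⟧.1# R⟦t⟧.- RS.var RS.*ₛ RS.var
    denK numK : KS.Series
    denK = K⟦t⟧.1# K⟦t⟧.- KS.const (φ s) KS.*ₛ KS.var KS.+ₛ KS.var KS.*ₛ KS.var
    numK = K⟦t⟧.1# K⟦t⟧.- KS.var KS.*ₛ KS.var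

    map-s*var : φ ∘ (RS.const s RS.*ₛ RS.var) ≈ₛ KS.const (φ s) KS.*ₛ KS.var
    map-s*var = K⟦t⟧.trans (map-* (RS.const s) RS.var)
      (KS.*ₛ-cong {φ ∘ RS.const s} {KS.const (φ s)} {φ ∘ RS.var} {KS.var} (map-const s) map-var)

    map-den : φ ∘ denR ≈ₛ denK
    map-den n = trans (φ-+ _ _) (+-cong
      (map-1-_ {RS.const s RS.*ₛ RS.var} {KS.const (φ s) KS.*ₛ KS.var} map-s*var n) (map-var*var n))

-- The equations to which identities between fractions with denominators 1 or
-- powers of x unfold.
module FractionEquations {c ℓ} (R : CommutativeRing c ℓ) where
  open CommutativeRing R
  open Algebra.Properties.Semiring.Exp semiring using (_^_)
  open import Algebra.Solver.Ring.NaturalCoefficients.Default commutativeSemiring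
    using (solve; _:+_; _:*_; _:=_; con)

  sum-equation : ∀ a b → (a + b) * (1# * 1#) ≈ (a * 1# + b * 1#) * 1#
  sum-equation = solve 2 (λ a b → (a :+ b) :* (con 1 :* con 1) := (a :* con 1 :+ b :* con 1) :* con 1) refl

  product-equation : ∀ a b → (a * b) * (1# * 1#) ≈ (a * b) * 1#
  product-equation a b = *-congˡ (*-identityˡ 1#)

  inverse-equation : ∀ x → (x * 1#) * 1# ≈ 1# * (1# * (x * 1#))
  inverse-equation = solve 1 (λ x → (x :* con 1) :* con 1 := con 1 :* (con 1 :* (x :* con 1))) refl

  power-equation : ∀ x n → 1# * (x ^ 1 * x ^ suc n) ≈ (1# * 1#) * x ^ (2 ℕ.+ n)
  power-equation x n = solve 2 (λ x p → con 1 :* ((x :* con 1) :* p) := (con 1 :* con 1) :* (x :* p)) refl x (x ^ suc n)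

-- The instance over the rational functions.

private
  module ℚ[x] = CommutativeRing ℚ[x]
  module ℚ⟮x⟯ = CommutativeRing ℚ⟮x⟯
  module ℚ⟮x⟯^ = Algebra.Properties.Semiring.Exp ℚ⟮x⟯.semiring
  module ℚ⟮x⟯ₓ = Algebra.Properties.Semiring.Mult ℚ⟮x⟯.semiring
open Polynomials ℚ-ring using (X; constₚ; _≈ₚ_; _+ₚ_; _*ₚ_)

fromPolynomial-cong : ∀ {p q} → p ≈ₚ q → fromPolynomial p ℚ⟮x⟯.≈ fromPolynomial q
fromPolynomial-cong {p} {q} p≈q = ℚ[x].*-congʳ {ℚ[x].1#} {p} {q} p≈q

fromPolynomial-+ : ∀ p q → fromPolynomial (p +ₚ q) ℚ⟮x⟯.≈ fromPolynomial p ℚ⟮x⟯.+ fromPolynomial q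
fromPolynomial-+ = FractionEquations.sum-equation ℚ[x]

fromPolynomial-* : ∀ p q → fromPolynomial (p *ₚ q) ℚ⟮x⟯.≈ fromPolynomial p ℚ⟮x⟯.* fromPolynomial q
fromPolynomial-* = FractionEquations.product-equation ℚ[x]

fromPolynomial-isHomomorphism : IsRingHomomorphism ℚ[x].rawRing ℚ⟮x⟯.rawRing fromPolynomial
fromPolynomial-isHomomorphism = record
  { isSemiringHomomorphism = record
    { isNearSemiringHomomorphism = record
      { +-isMonoidHomomorphism = record
        { isMagmaHomomorphism = record
          { isRelHomomorphism = record { cong = λ {p} {q} → fromPolynomial-cong {p} {q} }
          ; homo              = fromPolynomial-+
          }
        ; ε-homo = ℚ⟮x⟯.refl {ℚ⟮x⟯.0#}
        }
      ; *-homo = fromPolynomial-*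
      }
    ; 1#-homo = ℚ⟮x⟯.refl {ℚ⟮x⟯.1#}
    }
  ; -‿homo = λ p → ℚ⟮x⟯.refl {fromPolynomial (ℚ[x].- p)}
  }

fromℕ-× : ∀ n → fromℕ n ℚ⟮x⟯.≈ n ℚ⟮x⟯ₓ.× ℚ⟮x⟯.1#
fromℕ-× zero    = fromPolynomial-cong {constₚ (ℕ→ℚ 0)} {ℚ[x].0#} λ { zero → ≡.refl ; (suc _) → ≡.refl }
fromℕ-× (suc n) = ℚ⟮x⟯.trans {fromℕ (suc n)} {fromPolynomial (constₚ (ℕ→ℚ 1) +ₚ constₚ (ℕ→ℚ n))} {suc n ℚ⟮x⟯ₓ.× ℚ⟮x⟯.1#}
  (fromPolynomial-cong {constₚ (ℕ→ℚ (suc n))} {constₚ (ℕ→ℚ 1) +ₚ constₚ (ℕ→ℚ n)}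
    λ { zero → ℕ→ℚ-+ 1 n ; (suc _) → ≡.refl })
  (ℚ⟮x⟯.trans {fromPolynomial (constₚ (ℕ→ℚ 1) +ₚ constₚ (ℕ→ℚ n))} {fromℕ 1 ℚ⟮x⟯.+ fromℕ n} {suc n ℚ⟮x⟯ₓ.× ℚ⟮x⟯.1#}
    (fromPolynomial-+ (constₚ (ℕ→ℚ 1)) (constₚ (ℕ→ℚ n)))
    (ℚ⟮x⟯.+-congˡ {fromℕ 1} {fromℕ n} {n ℚ⟮x⟯ₓ.× ℚ⟮x⟯.1#} (fromℕ-× n)))

x⁻¹ : RationalFunction
x⁻¹ = x^ -[1+ 0 ]

x*x⁻¹ : fromPolynomial X ℚ⟮x⟯.* x⁻¹ ℚ⟮x⟯.≈ ℚ⟮x⟯.1#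
x*x⁻¹ = FractionEquations.inverse-equation ℚ[x] X

-- On the left stands one fraction with denominator `X ^ suc n`, on the right an iterated product of
-- fractions `1/x`; they agree after cross-multiplication.
x^-neg : ∀ n → x^ -[1+ n ] ℚ⟮x⟯.≈ x⁻¹ ℚ⟮x⟯^.^ suc n
x^-neg zero    = ℚ⟮x⟯.sym {x⁻¹ ℚ⟮x⟯.* ℚ⟮x⟯.1#} {x⁻¹} (ℚ⟮x⟯.*-identityʳ x⁻¹)
x^-neg (suc n) = ℚ⟮x⟯.trans {x^ -[1+ suc n ]} {x⁻¹ ℚ⟮x⟯.* x^ -[1+ n ]} {x⁻¹ ℚ⟮x⟯^.^ (2 ℕ.+ n)}
  (FractionEquations.power-equation ℚ[x] X n)
  (ℚ⟮x⟯.*-congˡ {x⁻¹} {x^ -[1+ n ]} {x⁻¹ ℚ⟮x⟯^.^ suc n} (x^-neg n))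

-- Written exactly as in `chebyshevDen`, so that `chebyshevGF-spec` serves as the equation for
-- `s = 2X`.
2X : ℚ[x].Carrier
2X = constₚ (ℕ→ℚ 2) *ₚ X

2X≈X+X : 2X ≈ₚ X +ₚ X
2X≈X+X = ℚ[x].trans {2X} {(ℚ[x].1# +ₚ ℚ[x].1#) *ₚ X} {X +ₚ X}
  (ℚ[x].*-congʳ {X} {constₚ (ℕ→ℚ 2)} {ℚ[x].1# +ₚ ℚ[x].1#} λ { zero → ≡.refl ; (suc _) → ≡.refl })
  (ℚ[x].trans {(ℚ[x].1# +ₚ ℚ[x].1#) *ₚ X} {ℚ[x].1# *ₚ X +ₚ ℚ[x].1# *ₚ X} {X +ₚ X}
    (ℚ[x].distribʳ X ℚ[x].1# ℚ[x].1#)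
    (ℚ[x].+-cong {ℚ[x].1# *ₚ X} {X} {ℚ[x].1# *ₚ X} {X} (ℚ[x].*-identityˡ X) (ℚ[x].*-identityˡ X)))

from2X : fromPolynomial 2X ℚ⟮x⟯.≈ fromPolynomial X ℚ⟮x⟯.+ fromPolynomial X
from2X = ℚ⟮x⟯.trans {fromPolynomial 2X} {fromPolynomial (X +ₚ X)} {fromPolynomial X ℚ⟮x⟯.+ fromPolynomial X}
  (fromPolynomial-cong {2X} {X +ₚ X} 2X≈X+X) (fromPolynomial-+ X X)

private
  module ℚ[x]⟦t⟧→ℚ⟮x⟯⟦t⟧ = SeriesHomomorphism ℚ[x] ℚ⟮x⟯ fromPolynomial-isHomomorphism

chebyshevGF-equation : IsChebyshevGF ℚ[x] 2X chebyshevGF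
chebyshevGF-equation = isChebyshevGF chebyshevGF-spec

chebyshevSetting : ChebyshevSetting ℚ⟮x⟯
chebyshevSetting = record
  { q        = fromℚ
  ; q-ℕ      = fromℕ-×
  ; x        = fromPolynomial X
  ; y        = x⁻¹
  ; s        = fromPolynomial 2X
  ; xy≈1     = x*x⁻¹
  ; s≈2x     = from2X
  ; xᶻ       = x^_
  ; xᶻ-neg   = x^-neg
  ; τ        = λ p → fromPolynomial (T p)
  ; τ-spec   = ℚ[x]⟦t⟧→ℚ⟮x⟯⟦t⟧.map-chebyshevGF {2X} {chebyshevGF} chebyshevGF-equation
  ; τ⟨_⟩     = λ k p → fromPolynomial (T⟨ k ⟩ p)
  ; τ⟨⟩-spec = ℚ[x]⟦t⟧→ℚ⟮x⟯⟦t⟧.map-^ chebyshevGF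
  }

open CommutativeRing ℚ⟮x⟯ using (_≈_; _+_; _*_; -_; 1#)
open Algebra.Properties.Semiring.Exp (CommutativeRing.semiring ℚ⟮x⟯) using (_^_)
open Sums ℚ⟮x⟯

ℚ⟮x⟯-identity : ChebyshevIdentity _≈_ _+_ _*_ -_ 1# _^_ sumRange sumTriples
  fromℚ fromℕ x^_ (λ p → fromPolynomial (T p)) (λ α p → fromPolynomial (T⟨ α ⟩ p))
ℚ⟮x⟯-identity = CoefficientComparison.identity ℚ⟮x⟯ chebyshevSetting

theorem7 : ∀ (n N : ℕ) → 1 ≤ N →
    fromℕ (2 ^ℕ (N +ℕ 1) *ℕ N !) *
    (∑[ s + m + p ≡ n ]
    fromℕ ((N +ℕ s) C s) * fromℕ ((m +ℕ N) C m) * (- 1#) ^ m * fromPolynomial (T⟨ N +ℕ 1 ⟩ p))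
    ≈
    (∑[ 1 ≤ i ≤ N ] ∑[ 0 ≤ l ≤ i ]
    fromℚ (a i N) * fromℚ (i !/ l !) *
    (∑[ m + s + p ≡ n ]
    fromℕ ((2 *ℕ N +ℕ m ∸ i ∸ 1) C m) * fromℕ ((i +ℕ s ∸ l) C s) *
    fromℚ (falling (ℕ→ℚ (p +ℕ l)) l) *
    x^ (+ i -ℤ + (2 *ℕ N) -ℤ + m) * fromPolynomial (T (p +ℕ l))))
    +
    (∑[ 1 ≤ i ≤ N ] ∑[ 0 ≤ l ≤ i ]
    fromℚ (a i N) * fromℚ (i !/ l !) * (- 1#) ^ (i ∸ l) *
    (∑[ m + s + p ≡ n ]
    (- 1#) ^ s * fromℕ ((2 *ℕ N +ℕ m ∸ i ∸ 1) C m) * fromℕ ((i +ℕ s ∸ l) C s) *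
    fromℚ (falling (ℕ→ℚ (p +ℕ l)) l) *
    x^ (+ i -ℤ + (2 *ℕ N) -ℤ + m) * fromPolynomial (T (p +ℕ l))))
theorem7 = ChebyshevIdentity.holds ℚ⟮x⟯-identity
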